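{- Let $n\ge1$, let $k_1,\dots,k_n$ be positive integers and let $f_1,\dots,f_n:\mathbb{N}\to\mathbb{Q}$ (extended by $f_i(0)=0$). Then: (i) There exists a function $g:\mathbb{N}\to\mathbb{Q}$ such that $S_{k_1,f_1}\,|\,\cdots\,|\,S_{k_n,f_n}=S_{k_1+\cdots+k_n,\,g}$; in fact $$g=\sum_{\alpha\in\Pi(n)}\mu(\alpha,\mathbf{1})\,\partial^{\ell(\alpha)-1}\mathop{\ast}_{A\in\alpha}f_A,\qquad f_A=\prod_{a\in A}f_a .$$ (ii) If $n\ge2$ and $f_1(x)=x$ for all $x$, then $\partial g=f_1\,\partial\tilde g$, where $\tilde g$ is the function associated by (i) to $(k_2,f_2),\dots,(k_n,f_n)$, i.e. $S_{k_2,f_2}\,|\,\cdots\,|\,S_{k_n,f_n}=S_{k_2+\cdots+k_n,\tilde g}$.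
   Context: Partitions $\lambda=(\lambda_1\ge\lambda_2\ge\dots)$, $\mathscr{P}$ the set of all partitions, $r_m(\lambda)=\#\{i:\lambda_i=m\}$; $\mathbb{N}=\{1,2,\dots\}$. For $k>0$ and $f:\mathbb{N}\to\mathbb{Q}$ with $f(0):=0$, $S_{k,f}(\lambda)=-\frac{B_{k+1}}{2(k+1)}\delta_{f,\mathrm{id}}+\sum_{m\ge1}m^kf(r_m(\lambda))$, where $B_j$ are Bernoulli numbers and $\delta_{f,\mathrm{id}}=1$ if $f$ is the identity and $0$ otherwise. Induced product: with $u_\lambda=\prod_{i:\lambda_i>0}u_{\lambda_i}$ and $\langle f\rangle_{\vec u}=\frac{\sum_\lambda f(\lambda)u_\lambda}{\sum_\lambda u_\lambda}\in\mathbb{Q}[[u_1,u_2,\dots]]$ (a linear bijection $\mathbb{Q}^{\mathscr{P}}\to\mathbb{Q}[[u_1,u_2,\dots]]$), $f\odot g$ is defined by $\langle f\odot g\rangle_{\vec u}=\langle f\rangle_{\vec u}\langle g\rangle_{\vec u}$. $\Pi(n)$ is the set of set partitions of $\{1,\dots,n\}$, $\ell(\alpha)$ the number of blocks of $\alpha$, $\mathbf{1}=\{\{1,\dots,n\}\}$, and $\mu(\alpha,\mathbf{1})=(-1)^{\ell(\alpha)-1}(\ell(\alpha)-1)!$. For $h_1,\dots,h_n:\mathscr{P}\to\mathbb{Q}$ the connected product is $h_1|\cdots|h_n=\sum_{\alpha\in\Pi(n)}\mu(\alpha,\mathbf{1})\bigodot_{A\in\alpha}h_A$, where $h_A=\prod_{a\in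 A}h_a$ (pointwise product). For $f,g:\mathbb{N}\to\mathbb{Q}$: the discrete convolution is $(f\ast g)(n)=\sum_{i=1}^{n-1}f(i)g(n-i)$, and $\mathop{\ast}_{A\in\alpha}$ denotes the iterated convolution over the blocks of $\alpha$; the discrete derivative is $\partial f(n)=f(n)-f(n-1)$ for $n\ge2$, $\partial f(1)=f(1)$. The function $g$ is extended by $g(0)=0$.
   Formalization: Part (i) as printed fails when n ≥ 2, g is the identity and B_{K+1} ≠ 0, K = k_1+…+k_n (e.g. f_1 = 1, f_2(m) = m(m+1)/2, k = (1,2)); that case is excluded, and there the identity is proved without the Bernoulli constant. Whether each f_i and g is the identity is taken as decided. -}

module Defs where

open import Algebra.Bundles using (CommutativeRing)
open import Data.Fin.Base using (Fin; toℕ) renaming (zero to fzero; suc to fsuc)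
open import Data.Integer.Base as ℤ using (ℤ; 1ℤ; -1ℤ)
open import Data.List.Base using (List; []; _∷_; _++_; map; concatMap; foldr; length; filter; replicate; applyUpTo; tabulate)
open import Data.List.NonEmpty.Base as List⁺ using (List⁺; _∷_; _∷⁺_)
import Data.List.Properties as List
open import Data.List.Relation.Unary.All as All using (All; []; _∷_)
import Data.List.Relation.Unary.All.Properties as All
open import Data.List.Relation.Unary.AllPairs using (AllPairs; []; _∷_)
import Data.List.Relation.Unary.AllPairs.Properties as AllPairs
open import Data.List.Relation.Unary.Linked using (Linked)
open import Data.List.Relation.Unary.Linked.Properties using (AllPairs⇒Linked)
open import Data.Nat.Base as ℕ using (ℕ; zero; suc; NonZero; _∸_; _≤_; _<_; _≥_; s≤s; z≤n)
open import Data.Nat.Combinatorics.Base using (_C_)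
open import Data.Nat.GeneralisedArithmetic using (iterate)
open import Data.Nat.ListAction using () renaming (sum to sumℕ)
import Data.Nat.Properties as ℕ
open import Data.Product.Base using (_×_)
open import Data.Rational.Base using (ℚ; 0ℚ; 1ℚ; _+_; _-_; _*_; -_; _/_)
import Data.Rational.Properties as ℚ
open import Data.Vec.Base as Vec using (Vec)
open import Function.Base using (_∘_; const)
open import Relation.Binary.PropositionalEquality using (_≡_; _≢_; _≗_; refl; sym; trans; cong; cong₂; module ≡-Reasoning)
open import Relation.Nullary.Decidable using (Dec; does)
open import Data.Bool.Base using (if_then_else_)

open import Algebra.Properties.Semiring.Sum (CommutativeRing.semiring ℚ.+-*-commutativeRing)
  using (sum-syntax; sum⁺-syntax; sum-cong-≗; ∑-distrib-+; ∑-comm; *-distribˡ-sum; *-distribʳ-sum; sum-replicate-zero)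

infixl 7 _·_ _⊙_ _∗_

fromℕ : ℕ → ℚ
fromℕ m = ℤ.+ m / 1

sumℚ productℚ : List ℚ → ℚ
sumℚ     = foldr _+_ 0ℚ
productℚ = foldr _*_ 1ℚ

------------------------------------------------------------------------
-- Bernoulli numbers

-- From  Σ_{j ≤ m} C(m+1,j) B_j = 0  for m ≥ 1.
nextBernoulli : ∀ m → Vec ℚ m → ℚ
nextBernoulli zero      _  = 1ℚ
nextBernoulli m@(suc _) bs =
  - (1ℤ / suc m) * ∑[ j < m ] (fromℕ (suc m C toℕ j) * Vec.lookup bs j)

bernoulliBelow : ∀ m → Vec ℚ m
bernoulliBelow zero    = Vec.[]
bernoulliBelow (suc m) = bernoulliBelow m Vec.∷ʳ nextBernoulli m (bernoulliBelow m)

bernoulli : ℕ → ℚ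
bernoulli m = nextBernoulli m (bernoulliBelow m)

------------------------------------------------------------------------
-- Functions on the positive integers

Arith : Set
Arith = (m : ℕ) .{{_ : NonZero m}} → ℚ

infix 4 _≐_
_≐_ : Arith → Arith → Set
f ≐ g = ∀ m .{{_ : NonZero m}} → f m ≡ g m

IsId : Arith → Set
IsId f = f ≐ λ m → fromℕ m

ext : Arith → ℕ → ℚ
ext f zero    = 0ℚ
ext f (suc m) = f (suc m)

-- The summation index i = 1, …, n−1 is suc (toℕ j).
_∗_ : Arith → Arith → Arith
(f ∗ g) n = ∑[ j < n ∸ 1 ] (f (suc (toℕ j)) * ext g (n ∸ suc (toℕ j)))

∂ : Arith → Arith
∂ f (suc zero)      = f 1
∂ f (suc n@(suc _)) = f (suc n) - f n

------------------------------------------------------------------------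
-- Set partitions

SetPartition : Set → Set
SetPartition A = List⁺ (List⁺ A)

insertInBlock : {A : Set} → A → List (List⁺ A) → List (SetPartition A)
insertInBlock x []       = []
insertInBlock x (B ∷ Bs) = ((x ∷⁺ B) ∷ Bs) ∷ map (B ∷⁺_) (insertInBlock x Bs)

-- Each set partition of {x} ∪ xs arises exactly once from one of xs, by making
-- {x} a block of its own or by putting x in one of the existing blocks.
setPartitions : {A : Set} → A → List A → List (SetPartition A)
setPartitions x []       = List⁺.[ List⁺.[ x ] ] ∷ []
setPartitions x (y ∷ ys) = concatMap
  (λ α → (List⁺.[ x ] ∷⁺ α) ∷ insertInBlock x (List⁺.toList α)) (setPartitions y ys)

-- The set partitions of an index set of size 1 + n.
Π : ∀ n → List (SetPartition (Fin (suc n)))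
Π n = setPartitions fzero (tabulate fsuc)

ℓ : {A : Set} → SetPartition A → ℕ
ℓ = List⁺.length

möbius : {A : Set} → SetPartition A → ℚ
möbius α = (-1ℤ ℤ.^ (ℓ α ∸ 1) ℤ.* ℤ.+ ((ℓ α ∸ 1) ℕ.!)) / 1

------------------------------------------------------------------------
-- Integer partitions

record Partition : Set where
  constructor mkPartition
  field
    parts     : List ℕ
    .sorted   : Linked _≥_ parts
    .positive : All NonZero parts

open Partition public

∣_∣ : Partition → ℕ
∣ p ∣ = sumℕ (parts p)

multiplicity : ℕ → Partition → ℕ
multiplicity m p = length (filter (ℕ._≟ m) (parts p))

PFun : Set
PFun = Partition → ℚ

-- The parts of p are at most ∣ p ∣, so summing over 1 ≤ m ≤ ∣ p ∣ loses nothing.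
powerSum : ℕ → Arith → PFun
powerSum k f p =
  ∑[ j < ∣ p ∣ ] (fromℕ (suc (toℕ j) ℕ.^ k) * ext f (multiplicity (suc (toℕ j)) p))

δ : {P : Set} → Dec P → ℚ
δ P? = if does P? then 1ℚ else 0ℚ

-- Whether f is the identity is classically but not constructively decided, so
-- the value of the Kronecker delta is read off from a decision.
S : ℕ → (f : Arith) → Dec (IsId f) → PFun
S k f f-id? p =
  - (bernoulli (suc k) * (1ℤ / (2 ℕ.* suc k))) * δ f-id? + powerSum k f p

------------------------------------------------------------------------
-- Power series in u₁, u₂, …

-- r₁ ∷ … ∷ r_N ∷ [] is the monomial u₁^r₁ ⋯ u_N^r_N.
Monomial : Set
Monomial = List ℕ

-- A series is its family of coefficients. Monomials that differ by trailing
-- zeros are the same; see Respects below.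
PowerSeries : Set
PowerSeries = Monomial → ℚ

-- The Cauchy product, one variable at a time.
_·_ : PowerSeries → PowerSeries → PowerSeries
(F · G) []       = F [] * G []
(F · G) (r ∷ rs) = ∑[ i ≤ r ] (((F ∘ (toℕ i ∷_)) · (G ∘ (r ∸ toℕ i ∷_))) rs)

one : PowerSeries
one []           = 1ℚ
one (zero  ∷ rs) = one rs
one (suc _ ∷ _)  = 0ℚ

-- The decreasing list in which m, m+1, … have the multiplicities rs.
partsFrom : ℕ → Monomial → List ℕ
partsFrom m []       = []
partsFrom m (r ∷ rs) = partsFrom (suc m) rs ++ replicate r m

partsFrom-≥ : ∀ m rs → All (_≥ m) (partsFrom m rs)
partsFrom-≥ m []       = []
partsFrom-≥ m (r ∷ rs) =
  All.++⁺ (All.map ℕ.<⇒≤ (partsFrom-≥ (suc m) rs)) (All.replicate⁺ r ℕ.≤-refl)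

partsFrom-sorted : ∀ m rs → AllPairs _≥_ (partsFrom m rs)
partsFrom-sorted m []       = []
partsFrom-sorted m (r ∷ rs) = AllPairs.++⁺ (partsFrom-sorted (suc m) rs) (replicate-sorted r)
  (All.map (λ m<x → All.replicate⁺ r (ℕ.<⇒≤ m<x)) (partsFrom-≥ (suc m) rs))
  where
  replicate-sorted : ∀ r → AllPairs _≥_ (replicate r m)
  replicate-sorted zero    = []
  replicate-sorted (suc r) = All.replicate⁺ r ℕ.≤-refl ∷ replicate-sorted r

-- The bijection between monomials u_λ and partitions λ, and its inverse.
fromMonomial : Monomial → Partition
fromMonomial rs = mkPartition (partsFrom 1 rs)
  (AllPairs⇒Linked (partsFrom-sorted 1 rs)) (All.map ℕ.>-nonZero (partsFrom-≥ 1 rs))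

toMonomial : Partition → Monomial
toMonomial p = applyUpTo (λ i → multiplicity (suc i) p) ∣ p ∣

-- Σ_λ f(λ) u_λ
series : PFun → PowerSeries
series f = f ∘ fromMonomial

Z : PowerSeries
Z = series (const 1ℚ)

-- 1 / Z = ∏_m (1 − u_m); see Z⁻¹·Z below.
Z⁻¹ : PowerSeries
Z⁻¹ []                 = 1ℚ
Z⁻¹ (zero        ∷ rs) = Z⁻¹ rs
Z⁻¹ (suc zero    ∷ rs) = - 1ℚ * Z⁻¹ rs
Z⁻¹ (suc (suc _) ∷ rs) = 0ℚ

⟨_⟩ : PFun → PowerSeries
⟨ f ⟩ = Z⁻¹ · series f

-- The f with ⟨ f ⟩ = F.
unbracket : PowerSeries → PFun
unbracket F p = (Z · F) (toMonomial p)

-- That ⟨ f ⊙ g ⟩ = ⟨ f ⟩ · ⟨ g ⟩ is ⟨⟩-⊙ below.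
_⊙_ : PFun → PFun → PFun
f ⊙ g = unbracket (⟨ f ⟩ · ⟨ g ⟩)

------------------------------------------------------------------------
-- The connected product and the function associated to f₁, …, f_n

prodPFun : {A : Set} → (A → PFun) → List⁺ A → PFun
prodPFun h A p = productℚ (map (λ a → h a p) (List⁺.toList A))

prodArith : {A : Set} → (A → Arith) → List⁺ A → Arith
prodArith f A m = productℚ (map (λ a → f a m) (List⁺.toList A))

⨀ : {A : Set} → (A → PFun) → SetPartition A → PFun
⨀ h α = List⁺.foldr₁ _⊙_ (List⁺.map (prodPFun h) α)

⊛ : {A : Set} → (A → Arith) → SetPartition A → Arith
⊛ f α = List⁺.foldr₁ _∗_ (List⁺.map (prodArith f) α)

connected : ∀ {n} → (Fin (suc n) → PFun) → PFun
connected {n} h p = sumℚ (map (λ α → möbius α * ⨀ h α p) (Π n))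

associated : ∀ {n} → (Fin (suc n) → Arith) → Arith
associated {n} f m = sumℚ (map (λ α → möbius α * iterate ∂ (⊛ f α) (ℓ α ∸ 1) m) (Π n))

total : ∀ {n} → (Fin n → ℕ) → ℕ
total k = sumℕ (tabulate k)

-- A connected product of n ≥ 2 functions vanishes at the empty partition, where
-- S_{k,g} has the value −B_{k+1}/(2(k+1)) if g is the identity. So S_{k,g} is
-- never such a product in this case, which does occur: for n = 2, f₁(m) = 1 and
-- f₂(m) = m(m+1)/2, the function associated to f₁, f₂ is the identity.
Exceptional : ℕ → ℕ → Arith → Set
Exceptional n k g = 2 ≤ n × IsId g × bernoulli (suc k) ≢ 0ℚ

------------------------------------------------------------------------
-- The induced product is the one transported along ⟨_⟩

infix 4 _≋_
data _≋_ : Monomial → Monomial → Set where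
  []≋[] : [] ≋ []
  []≋0∷ : ∀ {s} → [] ≋ s → [] ≋ 0 ∷ s
  0∷≋[] : ∀ {r} → r ≋ [] → 0 ∷ r ≋ []
  _∷≋_  : ∀ x {r s} → r ≋ s → x ∷ r ≋ x ∷ s

Respects : PowerSeries → Set
Respects F = ∀ {r s} → r ≋ s → F r ≡ F s

∷-respects : ∀ {F} → Respects F → ∀ x → Respects (F ∘ (x ∷_))
∷-respects F-resp x r≋s = F-resp (x ∷≋ r≋s)

·-respects : ∀ {F G} → Respects F → Respects G → Respects (F · G)
·-respects F-resp G-resp []≋[] = refl
·-respects {F} {G} F-resp G-resp ([]≋0∷ {s} []≋s) = begin
  F [] * G []                                   ≡⟨ cong₂ _*_ (F-resp ([]≋0∷ []≋[])) (G-resp ([]≋0∷ []≋[])) ⟩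
  F (0 ∷ []) * G (0 ∷ [])                       ≡⟨ ·-respects (∷-respects F-resp 0) (∷-respects G-resp 0) []≋s ⟩
  ((F ∘ (0 ∷_)) · (G ∘ (0 ∷_))) s               ≡⟨ ℚ.+-identityʳ _ ⟨
  (F · G) (0 ∷ s)                               ∎
  where open ≡-Reasoning
·-respects {F} {G} F-resp G-resp (0∷≋[] {r} r≋[]) = begin
  (F · G) (0 ∷ r)                               ≡⟨ ℚ.+-identityʳ _ ⟩
  ((F ∘ (0 ∷_)) · (G ∘ (0 ∷_))) r               ≡⟨ ·-respects (∷-respects F-resp 0) (∷-respects G-resp 0) r≋[] ⟩
  F (0 ∷ []) * G (0 ∷ [])                       ≡⟨ cong₂ _*_ (F-resp ([]≋0∷ []≋[])) (G-resp ([]≋0∷ []≋[])) ⟨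
  F [] * G []                                   ∎
  where open ≡-Reasoning
·-respects F-resp G-resp (x ∷≋ r≋s) = sum-cong-≗ {suc x} λ i →
  ·-respects (∷-respects F-resp (toℕ i)) (∷-respects G-resp (x ∸ toℕ i)) r≋s

·-cong : ∀ {F F′ G G′} → F ≗ F′ → G ≗ G′ → F · G ≗ F′ · G′
·-cong F≗ G≗ []       = cong₂ _*_ (F≗ []) (G≗ [])
·-cong F≗ G≗ (r ∷ rs) = sum-cong-≗ {suc r} λ i →
  ·-cong (F≗ ∘ (toℕ i ∷_)) (G≗ ∘ (r ∸ toℕ i ∷_)) rs

·-zeroˡ : ∀ G → const 0ℚ · G ≗ const 0ℚ
·-zeroˡ G []       = ℚ.*-zeroˡ (G [])
·-zeroˡ G (r ∷ rs) = trans (sum-cong-≗ {suc r} λ i → ·-zeroˡ (G ∘ (r ∸ toℕ i ∷_)) rs)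
                           (sum-replicate-zero (suc r))

one·F≗F : ∀ F → one · F ≗ F
one·F≗F F []       = ℚ.*-identityˡ (F [])
one·F≗F F (r ∷ rs) = begin
  (one · F) (r ∷ rs)                                 ≡⟨ cong₂ _+_ (one·F≗F (F ∘ (r ∷_)) rs)
                                                          (trans (sum-cong-≗ {r} λ i → ·-zeroˡ (F ∘ (r ∸ suc (toℕ i) ∷_)) rs)
                                                                 (sum-replicate-zero r)) ⟩
  F (r ∷ rs) + 0ℚ                                    ≡⟨ ℚ.+-identityʳ _ ⟩
  F (r ∷ rs)                                         ∎
  where open ≡-Reasoning

·-distribʳ-∑ : ∀ {n} (F : Fin n → PowerSeries) G →
               (λ r → ∑[ i < n ] F i r) · G ≗ (λ r → ∑[ i < n ] (F i · G) r)
·-distribʳ-∑ F G []       = *-distribʳ-sum (G []) (λ i → F i [])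
·-distribʳ-∑ {n} F G (r ∷ rs) = trans
  (sum-cong-≗ {suc r} λ j → ·-distribʳ-∑ (λ i → F i ∘ (toℕ j ∷_)) (G ∘ (r ∸ toℕ j ∷_)) rs)
  (∑-comm {suc r} {n} λ j i → ((F i ∘ (toℕ j ∷_)) · (G ∘ (r ∸ toℕ j ∷_))) rs)

·-distribˡ-∑ : ∀ {n} F (G : Fin n → PowerSeries) →
               F · (λ r → ∑[ i < n ] G i r) ≗ (λ r → ∑[ i < n ] (F · G i) r)
·-distribˡ-∑ F G []       = *-distribˡ-sum (F []) (λ i → G i [])
·-distribˡ-∑ {n} F G (r ∷ rs) = trans
  (sum-cong-≗ {suc r} λ j → ·-distribˡ-∑ (F ∘ (toℕ j ∷_)) (λ i → G i ∘ (r ∸ toℕ j ∷_)) rs)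
  (∑-comm {suc r} {n} λ j i → ((F ∘ (toℕ j ∷_)) · (G i ∘ (r ∸ toℕ j ∷_))) rs)

∑-triangle : ∀ r (a : ℕ → ℕ → ℕ → ℚ) →
  ∑[ i ≤ r ] (∑[ j ≤ toℕ i ] a (toℕ j) (toℕ i ∸ toℕ j) (r ∸ toℕ i)) ≡
  ∑[ j ≤ r ] (∑[ l ≤ r ∸ toℕ j ] a (toℕ j) (toℕ l) (r ∸ toℕ j ∸ toℕ l))
∑-triangle zero    a = refl
∑-triangle (suc r) a = begin
  (a 0 0 (suc r) + 0ℚ) + ∑[ i ≤ r ] (a 0 (suc (toℕ i)) (r ∸ toℕ i) + inner (toℕ i))
    ≡⟨ cong₂ _+_ (ℚ.+-identityʳ (a 0 0 (suc r))) (∑-distrib-+ {suc r} (λ i → a 0 (suc (toℕ i)) (r ∸ toℕ i)) (inner ∘ toℕ)) ⟩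
  a 0 0 (suc r) + (∑[ i ≤ r ] a 0 (suc (toℕ i)) (r ∸ toℕ i) + ∑[ i ≤ r ] inner (toℕ i))
    ≡⟨ ℚ.+-assoc (a 0 0 (suc r)) _ _ ⟨
  ∑[ l ≤ suc r ] a 0 (toℕ l) (suc r ∸ toℕ l) + ∑[ i ≤ r ] inner (toℕ i)
    ≡⟨ cong (∑[ l ≤ suc r ] a 0 (toℕ l) (suc r ∸ toℕ l) +_) (∑-triangle r (a ∘ suc)) ⟩
  ∑[ j ≤ suc r ] (∑[ l ≤ suc r ∸ toℕ j ] a (toℕ j) (toℕ l) (suc r ∸ toℕ j ∸ toℕ l))
    ∎
  where
  open ≡-Reasoning
  inner : ℕ → ℚ
  inner i = ∑[ j ≤ i ] a (suc (toℕ j)) (i ∸ toℕ j) (r ∸ i)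

·-assoc : ∀ F G H → (F · G) · H ≗ F · (G · H)
·-assoc F G H []       = ℚ.*-assoc (F []) (G []) (H [])
·-assoc F G H (r ∷ rs) = begin
  ((F · G) · H) (r ∷ rs)
    ≡⟨ sum-cong-≗ {suc r} (λ i → trans
         (·-distribʳ-∑ {suc (toℕ i)} (λ j → (F ∘ (toℕ j ∷_)) · (G ∘ (toℕ i ∸ toℕ j ∷_))) (H ∘ (r ∸ toℕ i ∷_)) rs)
         (sum-cong-≗ {suc (toℕ i)} λ j → ·-assoc (F ∘ (toℕ j ∷_)) (G ∘ (toℕ i ∸ toℕ j ∷_)) (H ∘ (r ∸ toℕ i ∷_)) rs)) ⟩
  ∑[ i ≤ r ] (∑[ j ≤ toℕ i ] term (toℕ j) (toℕ i ∸ toℕ j) (r ∸ toℕ i))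
    ≡⟨ ∑-triangle r term ⟩
  ∑[ j ≤ r ] (∑[ l ≤ r ∸ toℕ j ] term (toℕ j) (toℕ l) (r ∸ toℕ j ∸ toℕ l))
    ≡⟨ sum-cong-≗ {suc r} (λ j →
         ·-distribˡ-∑ {suc (r ∸ toℕ j)} (F ∘ (toℕ j ∷_)) (λ l → (G ∘ (toℕ l ∷_)) · (H ∘ (r ∸ toℕ j ∸ toℕ l ∷_))) rs) ⟨
  (F · (G · H)) (r ∷ rs)
    ∎
  where
  open ≡-Reasoning
  term : ℕ → ℕ → ℕ → ℚ
  term i j l = ((F ∘ (i ∷_)) · ((G ∘ (j ∷_)) · (H ∘ (l ∷_)))) rs

Z⁻¹·Z : Z⁻¹ · Z ≗ one
Z⁻¹·Z []                 = refl
Z⁻¹·Z (zero ∷ rs)        = trans (ℚ.+-identityʳ _) (Z⁻¹·Z rs)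
Z⁻¹·Z (suc r ∷ rs)       = begin
  (Z⁻¹ · Z) (suc r ∷ rs)
    ≡⟨ cong (λ x → X + ((F₁ · Z) rs + x))
         (trans (sum-cong-≗ {r} λ i → ·-zeroˡ Z rs) (sum-replicate-zero r)) ⟩
  X + ((F₁ · Z) rs + 0ℚ)
    ≡⟨ cong (X +_) (trans (ℚ.+-identityʳ _) (negate Z⁻¹ Z rs)) ⟩
  X + - 1ℚ * X
    ≡⟨ cong (X +_) (trans (sym (ℚ.neg-distribˡ-* 1ℚ X)) (cong -_ (ℚ.*-identityˡ X))) ⟩
  X + - X
    ≡⟨ ℚ.+-inverseʳ X ⟩
  0ℚ
    ∎
  where
  open ≡-Reasoning
  X : ℚ
  X = (Z⁻¹ · Z) rs
  F₁ : PowerSeries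
  F₁ = Z⁻¹ ∘ (1 ∷_)
  negate : ∀ F G → (λ s → - 1ℚ * F s) · G ≗ λ s → - 1ℚ * (F · G) s
  negate F G []       = ℚ.*-assoc (- 1ℚ) (F []) (G [])
  negate F G (s ∷ ss) = trans
    (sum-cong-≗ {suc s} λ i → negate (F ∘ (toℕ i ∷_)) (G ∘ (s ∸ toℕ i ∷_)) ss)
    (sym (*-distribˡ-sum {suc s} (- 1ℚ) λ i → ((F ∘ (toℕ i ∷_)) · (G ∘ (s ∸ toℕ i ∷_))) ss))

Z⁻¹-respects : Respects Z⁻¹
Z⁻¹-respects []≋[]                     = refl
Z⁻¹-respects ([]≋0∷ r≋s)               = Z⁻¹-respects r≋s
Z⁻¹-respects (0∷≋[] r≋s)               = Z⁻¹-respects r≋s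
Z⁻¹-respects (zero        ∷≋ r≋s)      = Z⁻¹-respects r≋s
Z⁻¹-respects (suc zero    ∷≋ r≋s)      = cong (- 1ℚ *_) (Z⁻¹-respects r≋s)
Z⁻¹-respects (suc (suc _) ∷≋ r≋s)      = refl

partsFrom-respects : ∀ m {r s} → r ≋ s → partsFrom m r ≡ partsFrom m s
partsFrom-respects m []≋[]        = refl
partsFrom-respects m ([]≋0∷ r≋s)  = trans (partsFrom-respects (suc m) r≋s) (sym (List.++-identityʳ _))
partsFrom-respects m (0∷≋[] r≋s)  = trans (List.++-identityʳ _) (partsFrom-respects (suc m) r≋s)
partsFrom-respects m (x ∷≋ r≋s)   = cong (_++ replicate x m) (partsFrom-respects (suc m) r≋s)

parts-injective : ∀ {p q} → parts p ≡ parts q → p ≡ q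
parts-injective refl = refl

series-respects : ∀ f → Respects (series f)
series-respects f r≋s = cong f (parts-injective (partsFrom-respects 1 r≋s))

⟨⟩-respects : ∀ f → Respects ⟨ f ⟩
⟨⟩-respects f = ·-respects Z⁻¹-respects (series-respects f)

exponent : Monomial → ℕ → ℕ
exponent []       _       = 0
exponent (r ∷ _)  zero    = r
exponent (_ ∷ rs) (suc i) = exponent rs i

count : ℕ → List ℕ → ℕ
count m xs = length (filter (ℕ._≟ m) xs)

count-++ : ∀ m xs ys → count m (xs ++ ys) ≡ count m xs ℕ.+ count m ys
count-++ m xs ys = trans (cong length (List.filter-++ (ℕ._≟ m) xs ys)) (List.length-++ (filter (ℕ._≟ m) xs))

count-none : ∀ m {xs} → All (_≢ m) xs → count m xs ≡ 0
count-none m none = cong length (List.filter-none (ℕ._≟ m) none)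

count-replicate : ∀ m r → count m (replicate r m) ≡ r
count-replicate m r = trans (cong length (List.filter-all (ℕ._≟ m) (All.replicate⁺ r refl))) (List.length-replicate r)

count-partsFrom : ∀ m rs i → count (m ℕ.+ i) (partsFrom m rs) ≡ exponent rs i
count-partsFrom m []       i       = refl
count-partsFrom m (r ∷ rs) zero    rewrite ℕ.+-identityʳ m = trans (count-++ m (partsFrom (suc m) rs) _)
  (cong₂ ℕ._+_ (count-none m (All.map ℕ.>⇒≢ (partsFrom-≥ (suc m) rs))) (count-replicate m r))
count-partsFrom m (r ∷ rs) (suc i) = begin
  count (m ℕ.+ suc i) (partsFrom (suc m) rs ++ replicate r m)
    ≡⟨ count-++ (m ℕ.+ suc i) (partsFrom (suc m) rs) _ ⟩
  count (m ℕ.+ suc i) (partsFrom (suc m) rs) ℕ.+ count (m ℕ.+ suc i) (replicate r m)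
    ≡⟨ cong₂ ℕ._+_ (trans (cong (λ k → count k (partsFrom (suc m) rs)) (ℕ.+-suc m i)) (count-partsFrom (suc m) rs i))
                   (count-none (m ℕ.+ suc i) (All.replicate⁺ r (ℕ.<⇒≢ (ℕ.m<m+n m ℕ.z<s)))) ⟩
  exponent rs i ℕ.+ 0
    ≡⟨ ℕ.+-identityʳ _ ⟩
  exponent rs i
    ∎
  where open ≡-Reasoning

count-large : ∀ m xs → sumℕ xs < m → count m xs ≡ 0
count-large m xs xs<m = count-none m (small xs xs<m)
  where
  small : ∀ xs → sumℕ xs < m → All (_≢ m) xs
  small []       _    = []
  small (x ∷ xs) xs<m = ℕ.<⇒≢ (ℕ.≤-<-trans (ℕ.m≤m+n x _) xs<m) ∷ small xs (ℕ.≤-<-trans (ℕ.m≤n+m _ x) xs<m)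

applyUpTo-≋ : ∀ n rs e → (∀ i → e i ≡ exponent rs i) → (∀ i → n ≤ i → e i ≡ 0) →
              applyUpTo e n ≋ rs
applyUpTo-≋ zero    []       e _  _ = []≋[]
applyUpTo-≋ zero    (r ∷ rs) e e≡ e₀ with trans (sym (e₀ 0 z≤n)) (e≡ 0)
... | refl = []≋0∷ (applyUpTo-≋ zero rs (e ∘ suc) (e≡ ∘ suc) (λ i _ → e₀ (suc i) z≤n))
applyUpTo-≋ (suc n) []       e e≡ e₀ rewrite e≡ 0 =
  0∷≋[] (applyUpTo-≋ n [] (e ∘ suc) (e≡ ∘ suc) (λ i n≤i → e₀ (suc i) (s≤s n≤i)))
applyUpTo-≋ (suc n) (r ∷ rs) e e≡ e₀ rewrite e≡ 0 =
  r ∷≋ applyUpTo-≋ n rs (e ∘ suc) (e≡ ∘ suc) (λ i n≤i → e₀ (suc i) (s≤s n≤i))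

toMonomial∘fromMonomial : ∀ rs → toMonomial (fromMonomial rs) ≋ rs
toMonomial∘fromMonomial rs = applyUpTo-≋ ∣ fromMonomial rs ∣ rs _ (count-partsFrom 1 rs)
  (λ i n≤i → count-large (suc i) (partsFrom 1 rs) (s≤s n≤i))

⟨⟩-unbracket : ∀ {F} → Respects F → ⟨ unbracket F ⟩ ≗ F
⟨⟩-unbracket {F} F-resp r = begin
  (Z⁻¹ · series (unbracket F)) r
    ≡⟨ ·-cong (λ _ → refl) (·-respects (series-respects (const 1ℚ)) F-resp ∘ toMonomial∘fromMonomial) r ⟩
  (Z⁻¹ · (Z · F)) r  ≡⟨ ·-assoc Z⁻¹ Z F r ⟨
  (Z⁻¹ · Z · F) r    ≡⟨ ·-cong Z⁻¹·Z (λ _ → refl) r ⟩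
  (one · F) r        ≡⟨ one·F≗F F r ⟩
  F r                ∎
  where open ≡-Reasoning

⟨⟩-⊙ : ∀ f g → ⟨ f ⊙ g ⟩ ≗ ⟨ f ⟩ · ⟨ g ⟩
⟨⟩-⊙ f g = ⟨⟩-unbracket (·-respects (⟨⟩-respects f) (⟨⟩-respects g))

{-# OPTIONS --safe #-}

-- Transported along ⟨_⟩, the connected product is the joint cumulant of the
-- expectation E h = ⟨ h ⟩, under which the multiplicities r₁, r₂, … are
-- independent. Over the dual numbers, the cumulant of x, y₁, …, y_n is the
-- ε-part of the cumulant of y₁, …, y_n for the tilted expectation
-- b ↦ E[(1+εx)b] / E[1+εx]: inserting x into a set partition, as a new block or
-- into an old one, is what the derivation E[B] ↦ E[xB] − E[x]E[B] does. Tilting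
-- by a sum of functions of independent variables tilts each variable separately,
-- so cumulants of such sums are additive. This reduces the claim to one
-- multiplicity, where E multiplies by 1 − u the generating function, so that a
-- product over ℓ blocks becomes 1 − u times ∂^(ℓ−1) of a convolution. For (ii),
-- tilting by r₁ itself is F ↦ F + ε u ∂F/∂u, a ring homomorphism, and cumulants
-- are natural under ring homomorphisms.

module Submission where

open import Defs
open import Data.Fin.Base using (Fin) renaming (zero to fzero; suc to fsuc)
open import Data.Nat.Base using (ℕ; suc; NonZero)
open import Data.Product.Base using (_×_; ∃)
open import Function.Base using (_∘_)
open import Relation.Binary.PropositionalEquality using (_≗_)
open import Relation.Nullary using (¬_; Dec)

open import Algebra.Bundles using (CommutativeRing)
open import Data.Fin.Base using (toℕ)
import Data.Fin.Permutation as Permutation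
import Data.Fin.Properties as Fin
open import Data.Integer.Base as ℤ using (ℤ; 1ℤ; -1ℤ)
import Data.Integer.Properties as ℤ
open import Data.List.Base using (List; []; _∷_; map; foldr; length; concatMap; _++_; applyUpTo; tabulate)
open import Data.List.NonEmpty.Base as List⁺ using (List⁺; _∷_; _∷⁺_)
open import Data.List.Properties using (map-cong; map-tabulate)
open import Data.Nat.Base as ℕ using (zero; _∸_; _!; _≤_; z≤n; s≤s)
open import Data.Nat.GeneralisedArithmetic using (iterate)
open import Data.Nat.ListAction using () renaming (sum to sumℕ)
import Data.Nat.Properties as ℕ
open import Data.Product.Base using (_,_; proj₁; proj₂)
open import Data.Rational.Base as ℚ using (ℚ; 0ℚ; 1ℚ; _/_; toℚᵘ)
import Data.Rational.Properties as ℚ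
import Data.Rational.Unnormalised.Base as ℚᵘ
import Data.Rational.Unnormalised.Properties as ℚᵘ
open import Data.Unit.Base using (⊤; tt)
open import Function.Base using (const)
open import Level using (0ℓ)
open import Relation.Binary.PropositionalEquality as ≡ using (_≡_)
open import Relation.Nullary.Decidable using (yes; no; decidable-stable)
open import Relation.Nullary.Negation using (contradiction)
import Algebra.Module.Construct.Idealization as Idealization
import Algebra.Module.Construct.TensorUnit as TensorUnit
import Algebra.Properties.CommutativeSemigroup
import Algebra.Properties.Group
import Algebra.Properties.Ring
import Algebra.Properties.Semiring.Exp
import Algebra.Properties.Semiring.Mult
import Algebra.Solver.Ring.NaturalCoefficients.Default as SemiringSolver
import Relation.Binary.Reasoning.Setoid

open import Algebra.Properties.Semiring.Sum (CommutativeRing.semiring ℚ.+-*-commutativeRing)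
  using (sum-syntax; sum⁺-syntax; sum-cong-≗; ∑-distrib-+; *-distribˡ-sum; *-distribʳ-sum; sum-replicate-zero; sum-permute)

open CommutativeRing using (Carrier)

-- Cumulants by tilting

infix 4 _[_≈_]
_[_≈_] : (R : CommutativeRing 0ℓ 0ℓ) → Carrier R → Carrier R → Set
R [ a ≈ b ] = CommutativeRing._≈_ R a b

private
  ℚ-ring : CommutativeRing 0ℓ 0ℓ
  ℚ-ring = ℚ.+-*-commutativeRing
  module ℚ-solver = SemiringSolver (CommutativeRing.commutativeSemiring ℚ-ring)
  open Algebra.Properties.CommutativeSemigroup (CommutativeRing.*-commutativeSemigroup ℚ-ring)
    using () renaming (x∙yz≈y∙xz to ℚ-x∙yz≈y∙xz)

infixl 6 _⊞_
infixl 7 _⊠_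
_⊞_ _⊠_ : {X : Set} → (X → ℚ) → (X → ℚ) → X → ℚ
(a ⊞ b) x = a x ℚ.+ b x
(a ⊠ b) x = a x ℚ.* b x

block : {I X : Set} → (I → X → ℚ) → List⁺ I → X → ℚ
block h B x = productℚ (map (λ i → h i x) (List⁺.toList B))

-- The dual numbers R[ε]/(ε²); (a , a′) is a + ε a′.
Dual : CommutativeRing 0ℓ 0ℓ → CommutativeRing 0ℓ 0ℓ
Dual R = record { isCommutativeRing = record
  { isRing = Idealization.isRingᴺ ring TensorUnit.bimodule
  ; *-comm = λ (a , a′) (b , b′) → *-comm a b ,
      trans (+-cong (*-comm a b′) (*-comm a′ b)) (+-comm (b′ * a) (b * a′)) } }
  where open CommutativeRing R

-- E[(1 + εx)b] / E[1 + εx] for an expectation E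
tilt : ∀ R {X : Set} → ((X → ℚ) → Carrier R) → (X → ℚ) → (X → ℚ) → Carrier (Dual R)
tilt R E x b = E b , E (x ⊠ b) + - E x * E b
  where open CommutativeRing R

-- The joint cumulant of h i and the h j, j ∈ js. Adding a variable x is
-- differentiating at 0 along the tilt by 1 + εx.
κ : {I X : Set} (R : CommutativeRing 0ℓ 0ℓ) → ((X → ℚ) → Carrier R) → (I → X → ℚ) → I → List I → Carrier R
κ R E h i []       = E (h i)
κ R E h i (j ∷ js) = proj₂ (κ (Dual R) (tilt R E (h i)) h j js)

κ-reindex : ∀ {I J X : Set} R (E : (X → ℚ) → Carrier R) (h : I → X → ℚ) (σ : J → I) j js →
            κ R E (h ∘ σ) j js ≡ κ R E h (σ j) (map σ js)
κ-reindex R E h σ j []       = ≡.refl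
κ-reindex R E h σ j (k ∷ ks) = ≡.cong proj₂ (κ-reindex (Dual R) (tilt R E (h (σ j))) h σ k ks)

κ-cong : ∀ {I X : Set} R {E E′ : (X → ℚ) → Carrier R} {h h′ : I → X → ℚ} →
         (∀ {a b} → a ≗ b → R [ E a ≈ E′ b ]) → (∀ i → h i ≗ h′ i) →
         ∀ i is → R [ κ R E h i is ≈ κ R E′ h′ i is ]
κ-cong R E≈ h≗ i []       = E≈ (h≗ i)
κ-cong R {E} {E′} {h} {h′} E≈ h≗ i (j ∷ js) = proj₂ (κ-cong (Dual R) tilt≈ h≗ j js)
  where
  open CommutativeRing R
  tilt≈ : ∀ {a b} → a ≗ b → Dual R [ tilt R E (h i) a ≈ tilt R E′ (h′ i) b ]
  tilt≈ a≗b = E≈ a≗b , +-cong (E≈ λ x → ≡.cong₂ ℚ._*_ (h≗ i x) (a≗b x))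
                              (*-cong (-‿cong (E≈ (h≗ i))) (E≈ a≗b))

record IsExpectation (R : CommutativeRing 0ℓ 0ℓ) {X : Set} (E : (X → ℚ) → Carrier R) : Set where
  open CommutativeRing R
  field
    E-cong : ∀ {a b} → a ≗ b → E a ≈ E b
    E-1    : E (const 1ℚ) ≈ 1#

module _ {R : CommutativeRing 0ℓ 0ℓ} {X : Set} {E : (X → ℚ) → Carrier R} (E-exp : IsExpectation R E) where
  open CommutativeRing R
  open IsExpectation E-exp

  -- The ε-part at `1` is E[x] - E[x] = 0, so normalisation survives tilting. This lets inductions
  -- along `κ` pass from `R` to `Dual R`.
  tilt-isExpectation : ∀ x → IsExpectation (Dual R) (tilt R E x)
  tilt-isExpectation x = record
    { E-cong = λ a≗b → E-cong a≗b , +-cong (E-cong λ i → ≡.cong (x i ℚ.*_) (a≗b i)) (*-congˡ (E-cong a≗b))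
    ; E-1    = E-1 , (begin
        E (x ⊠ const 1ℚ) + - E x * E (const 1ℚ)  ≈⟨ +-cong (E-cong (ℚ.*-identityʳ ∘ x)) (*-congˡ E-1) ⟩
        E x + - E x * 1#                         ≈⟨ +-congˡ (*-identityʳ _) ⟩
        E x + - E x                              ≈⟨ -‿inverseʳ _ ⟩
        0#                                       ∎)
    }
    where open Relation.Binary.Reasoning.Setoid setoid

-- Naturality under ring homomorphisms

record IsHom (R S : CommutativeRing 0ℓ 0ℓ) (φ : Carrier R → Carrier S) : Set where
  private
    module R = CommutativeRing R
    module S = CommutativeRing S
  field
    cong   : ∀ {a b} → a R.≈ b → φ a S.≈ φ b
    +-homo : ∀ a b → φ (a R.+ b) S.≈ φ a S.+ φ b
    *-homo : ∀ a b → φ (a R.* b) S.≈ φ a S.* φ b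
    -‿homo : ∀ a → φ (R.- a) S.≈ S.- φ a

dual-isHom : ∀ {R S φ} → IsHom R S φ → IsHom (Dual R) (Dual S) (λ (a , a′) → φ a , φ a′)
dual-isHom {R} {S} φ-hom = record
  { cong   = λ (a≈ , a′≈) → cong a≈ , cong a′≈
  ; +-homo = λ (a , a′) (b , b′) → +-homo a b , +-homo a′ b′
  ; *-homo = λ (a , a′) (b , b′) → *-homo a b , trans (+-homo _ _) (+-cong (*-homo a b′) (*-homo a′ b))
  ; -‿homo = λ (a , a′) → -‿homo a , -‿homo a′
  }
  where
  open IsHom φ-hom
  open CommutativeRing S using (trans; +-cong)

-- A cumulant is formed from values of `E` by ring operations only. A homomorphism therefore passes
-- through every tilt, acting componentwise on the dual numbers.
κ-natural : ∀ {I X : Set} {R S φ} → IsHom R S φ → ∀ {E : (X → ℚ) → Carrier R} {E′} →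
            (∀ a → S [ E′ a ≈ φ (E a) ]) → (h : I → X → ℚ) → ∀ i is →
            S [ κ S E′ h i is ≈ φ (κ R E h i is) ]
κ-natural φ-hom E′≈ h i []       = E′≈ (h i)
κ-natural {R = R} {S} {φ} φ-hom {E} {E′} E′≈ h i (j ∷ js) =
  proj₂ (κ-natural (dual-isHom φ-hom) tilt≈ h j js)
  where
  open IsHom φ-hom
  open CommutativeRing S
  tilt≈ : ∀ a → let (b , b′) = tilt R E (h i) a in Dual S [ tilt S E′ (h i) a ≈ (φ b , φ b′) ]
  tilt≈ a = E′≈ a , sym (trans (+-homo _ _) (+-cong (sym (E′≈ _))
    (trans (*-homo _ _) (*-cong (trans (-‿homo _) (-‿cong (sym (E′≈ _)))) (sym (E′≈ _))))))

module _ (R : CommutativeRing 0ℓ 0ℓ) where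
  open CommutativeRing R
  open Algebra.Properties.Ring ring using (-0#≈0#; -‿distribˡ-*; -‿distribʳ-*)

  constant-isHom : IsHom R (Dual R) (_, 0#)
  constant-isHom = record
    { cong   = _, refl
    ; +-homo = λ _ _ → refl , sym (+-identityˡ 0#)
    ; *-homo = λ a b → refl , sym (trans (+-cong (zeroʳ a) (zeroˡ b)) (+-identityˡ 0#))
    ; -‿homo = λ _ → refl , sym -0#≈0#
    }

  -- The substitution ε ↦ cε. For a homogeneous expectation it carries the tilt by x to the tilt by
  -- cx.
  rescale-isHom : ∀ c → IsHom (Dual R) (Dual R) (λ (a , a′) → a , c * a′)
  rescale-isHom c = record
    { cong   = λ (a≈ , a′≈) → a≈ , *-congˡ a′≈
    ; +-homo = λ _ _ → refl , distribˡ c _ _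
    ; *-homo = λ (a , a′) (b , b′) → refl ,
        solve 5 (λ c a a′ b b′ → c :* (a :* b′ :+ a′ :* b) := a :* (c :* b′) :+ (c :* a′) :* b) refl c a a′ b b′
    ; -‿homo = λ _ → refl , sym (-‿distribʳ-* c _)
    }
    where open SemiringSolver commutativeSemiring

  -- Tilting by `h i` changes nothing here: the tilted expectation has ε-part 0, and by naturality
  -- so does every cumulant formed from it.
  κ-multiplicative : ∀ {I X : Set} {E : (X → ℚ) → Carrier R} {h : I → X → ℚ} {i} →
                     (∀ b → E (h i ⊠ b) ≈ E (h i) * E b) → ∀ j js → κ R E h i (j ∷ js) ≈ 0#
  κ-multiplicative {E = E} {h} {i} E-mult j js = proj₂ (κ-natural constant-isHom tilt≈ h j js)
    where
    open Relation.Binary.Reasoning.Setoid setoid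
    tilt≈ : ∀ b → Dual R [ tilt R E (h i) b ≈ (E b , 0#) ]
    tilt≈ b = refl , (begin
      E (h i ⊠ b) + - E (h i) * E b        ≈⟨ +-cong (E-mult b) (sym (-‿distribˡ-* _ _)) ⟩
      E (h i) * E b + - (E (h i) * E b)    ≈⟨ -‿inverseʳ _ ⟩
      0#                                   ∎)

-- Additivity over independent variables

-- `E₁` and `E₂` are the marginals of `E` along `p₁` and `p₂`. The ring is arbitrary, so that
-- independence can be carried over to `Dual R` at each step of `κ`.
record Independent (R : CommutativeRing 0ℓ 0ℓ) {X X₁ X₂ : Set} (p₁ : X → X₁) (p₂ : X → X₂)
  (E : (X → ℚ) → Carrier R) (E₁ : (X₁ → ℚ) → Carrier R) (E₂ : (X₂ → ℚ) → Carrier R) : Set where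
  open CommutativeRing R
  field
    isExpectation  : IsExpectation R E
    isExpectation₁ : IsExpectation R E₁
    isExpectation₂ : IsExpectation R E₂
    +-homo         : ∀ a b → E (a ⊞ b) ≈ E a + E b
    *-homo         : ∀ a b → E ((a ∘ p₁) ⊠ (b ∘ p₂)) ≈ E₁ a * E₂ b

  open IsExpectation isExpectation public
  open IsExpectation isExpectation₁ public using () renaming (E-cong to E₁-cong; E-1 to E₁-1)
  open IsExpectation isExpectation₂ public using () renaming (E-cong to E₂-cong; E-1 to E₂-1)
  open Relation.Binary.Reasoning.Setoid setoid

  marginal-+ : ∀ a b → E ((a ∘ p₁) ⊞ (b ∘ p₂)) ≈ E₁ a + E₂ b
  marginal-+ a b = begin
    E ((a ∘ p₁) ⊞ (b ∘ p₂))
      ≈⟨ +-homo _ _ ⟩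
    E (a ∘ p₁) + E (b ∘ p₂)
      ≈⟨ +-cong (E-cong λ x → ≡.sym (ℚ.*-identityʳ _)) (E-cong λ x → ≡.sym (ℚ.*-identityˡ _)) ⟩
    E ((a ∘ p₁) ⊠ const 1ℚ) + E (const 1ℚ ⊠ (b ∘ p₂))
      ≈⟨ +-cong (*-homo a (const 1ℚ)) (*-homo (const 1ℚ) b) ⟩
    E₁ a * E₂ (const 1ℚ) + E₁ (const 1ℚ) * E₂ b
      ≈⟨ +-cong (trans (*-congˡ E₂-1) (*-identityʳ _)) (trans (*-congʳ E₁-1) (*-identityˡ _)) ⟩
    E₁ a + E₂ b
      ∎

-- Since ε² = 0, 1 + ε(a + b) = (1 + εa)(1 + εb). The tilt thus acts on each coordinate separately,
-- and the joint expectation still factors.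
tilt-independent : ∀ {R} {X X₁ X₂ : Set} {p₁ : X → X₁} {p₂ : X → X₂} {E E₁ E₂} →
                   Independent R p₁ p₂ E E₁ E₂ → ∀ a b →
                   Independent (Dual R) p₁ p₂ (tilt R E ((a ∘ p₁) ⊞ (b ∘ p₂))) (tilt R E₁ a) (tilt R E₂ b)
tilt-independent {R} {p₁ = p₁} {p₂} {E} {E₁} {E₂} ind a b = record
  { isExpectation  = tilt-isExpectation isExpectation x
  ; isExpectation₁ = tilt-isExpectation isExpectation₁ a
  ; isExpectation₂ = tilt-isExpectation isExpectation₂ b
  ; +-homo         = λ c d → +-homo c d , (begin
      E (x ⊠ (c ⊞ d)) + - E x * E (c ⊞ d)
        ≈⟨ +-cong (trans (E-cong λ y → ℚ.*-distribˡ-+ (x y) (c y) (d y)) (+-homo _ _)) (*-congˡ (+-homo c d)) ⟩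
      E (x ⊠ c) + E (x ⊠ d) + - E x * (E c + E d)
        ≈⟨ solve 5 (λ s t n u v → s :+ t :+ n :* (u :+ v) := (s :+ n :* u) :+ (t :+ n :* v)) refl _ _ _ _ _ ⟩
      (E (x ⊠ c) + - E x * E c) + (E (x ⊠ d) + - E x * E d)
        ∎)
  ; *-homo         = λ c d → *-homo c d , (begin
      E (x ⊠ ((c ∘ p₁) ⊠ (d ∘ p₂))) + - E x * E ((c ∘ p₁) ⊠ (d ∘ p₂))
        ≈⟨ +-cong (E-cong λ y → expand (a (p₁ y)) (b (p₂ y)) (c (p₁ y)) (d (p₂ y)))
             (*-cong (trans (-‿cong (marginal-+ a b)) (sym (-‿+-comm _ _))) (*-homo c d)) ⟩
      E ((((a ⊠ c) ∘ p₁) ⊠ (d ∘ p₂)) ⊞ ((c ∘ p₁) ⊠ ((b ⊠ d) ∘ p₂))) + (- E₁ a + - E₂ b) * (E₁ c * E₂ d)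
        ≈⟨ +-congʳ (trans (+-homo _ _) (+-cong (*-homo (a ⊠ c) d) (*-homo c (b ⊠ d)))) ⟩
      E₁ (a ⊠ c) * E₂ d + E₁ c * E₂ (b ⊠ d) + (- E₁ a + - E₂ b) * (E₁ c * E₂ d)
        ≈⟨ solve 6 (λ u v w z s t → u :* v :+ w :* z :+ (s :+ t) :* (w :* v) :=
                                     w :* (z :+ t :* v) :+ (u :+ s :* w) :* v) refl _ _ _ _ _ _ ⟩
      E₁ c * (E₂ (b ⊠ d) + - E₂ b * E₂ d) + (E₁ (a ⊠ c) + - E₁ a * E₁ c) * E₂ d
        ∎)
  }
  where
  open CommutativeRing R
  open Independent ind
  open Algebra.Properties.Ring ring using (-‿+-comm)
  open Relation.Binary.Reasoning.Setoid setoid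
  open SemiringSolver commutativeSemiring
  x = (a ∘ p₁) ⊞ (b ∘ p₂)
  expand : ∀ a b c d → (a ℚ.+ b) ℚ.* (c ℚ.* d) ≡ a ℚ.* c ℚ.* d ℚ.+ c ℚ.* (b ℚ.* d)
  expand a b c d = ≡.trans (ℚ.*-distribʳ-+ (c ℚ.* d) a b)
    (≡.cong₂ ℚ._+_ (≡.sym (ℚ.*-assoc a c d)) (ℚ-x∙yz≈y∙xz b c d))

-- Each tilt preserves independence, so only the case of a single variable is left, which is
-- `marginal-+` over iterated dual numbers.
κ-additive : ∀ {I} {R} {X X₁ X₂ : Set} {p₁ : X → X₁} {p₂ : X → X₂} {E E₁ E₂} → Independent R p₁ p₂ E E₁ E₂ →
             (a : I → X₁ → ℚ) (b : I → X₂ → ℚ) → ∀ i is →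
             R [ κ R E (λ i → (a i ∘ p₁) ⊞ (b i ∘ p₂)) i is ≈
                 CommutativeRing._+_ R (κ R E₁ a i is) (κ R E₂ b i is) ]
κ-additive ind a b i []       = Independent.marginal-+ ind (a i) (b i)
κ-additive ind a b i (j ∷ js) = proj₂ (κ-additive (tilt-independent ind (a i) (b i)) a b j js)

-- Homogeneity of cumulants

module _ {I X : Set} (c : I → ℚ) (h : I → X → ℚ) where

  scaled : I → X → ℚ
  scaled i x = c i ℚ.* h i x

  -- `γ` maps scalars into `R`; over `Dual R` it becomes q ↦ γ(q) + 0ε. The factor of the first
  -- variable comes out by the substitution ε ↦ γ(c i)ε, the others by induction.
  κ-homogeneous : ∀ R → let open CommutativeRing R in
                  (γ : ℚ → Carrier R) {E : (X → ℚ) → Carrier R} → IsExpectation R E →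
                  (∀ c a → E (λ x → c ℚ.* a x) ≈ γ c * E a) → ∀ i is →
                  κ R E scaled i is ≈ foldr (λ j → γ (c j) *_) 1# (i ∷ is) * κ R E h i is
  κ-homogeneous R γ {E} E-exp E-scale i [] =
    trans (E-scale (c i) (h i)) (*-congʳ (sym (*-identityʳ (γ (c i)))))
    where open CommutativeRing R
  κ-homogeneous R γ {E} E-exp E-scale i (j ∷ js) = begin
    proj₂ (κ (Dual R) (tilt R E (scaled i)) scaled j js)
      ≈⟨ proj₂ (κ-homogeneous (Dual R) (λ q → γ q , 0#) (tilt-isExpectation E-exp (scaled i)) tilt-scale j js) ⟩
    proj₁ Γ′ * proj₂ K′ + proj₂ Γ′ * proj₁ K′
      -- The scalars have no ε-part, which kills the second term of the product rule.
      ≈⟨ +-cong (*-cong (Γ′₁ (j ∷ js)) (proj₂ (κ-natural (rescale-isHom R (γ (c i))) tilt≈ h j js)))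
                (*-congʳ (Γ′₂ (j ∷ js))) ⟩
    Γ * (γ (c i) * K) + 0# * proj₁ K′
      ≈⟨ solve 4 (λ g u k v → g :* (u :* k) :+ con 0 :* v := (u :* g) :* k) refl Γ (γ (c i)) K (proj₁ K′) ⟩
    γ (c i) * Γ * K
      ∎
    where
    open CommutativeRing R
    open IsExpectation E-exp
    open Algebra.Properties.Ring ring using (-‿distribʳ-*)
    open Relation.Binary.Reasoning.Setoid setoid
    open SemiringSolver commutativeSemiring
    module D = CommutativeRing (Dual R)
    Γ  = foldr (λ j → γ (c j) *_) 1# (j ∷ js)
    Γ′ = foldr (λ j → (γ (c j) , 0#) D.*_) D.1# (j ∷ js)
    K  = proj₂ (κ (Dual R) (tilt R E (h i)) h j js)
    K′ = κ (Dual R) (tilt R E (scaled i)) h j js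
    Γ′₁ : ∀ is → proj₁ (foldr (λ j → (γ (c j) , 0#) D.*_) D.1# is) ≈ foldr (λ j → γ (c j) *_) 1# is
    Γ′₁ []       = refl
    Γ′₁ (i ∷ is) = *-congˡ (Γ′₁ is)
    Γ′₂ : ∀ is → proj₂ (foldr (λ j → (γ (c j) , 0#) D.*_) D.1# is) ≈ 0#
    Γ′₂ []       = refl
    Γ′₂ (i ∷ is) = trans (+-cong (trans (*-congˡ (Γ′₂ is)) (zeroʳ _)) (zeroˡ _)) (+-identityˡ 0#)
    tilt-scale : ∀ q a → tilt R E (scaled i) (λ x → q ℚ.* a x) D.≈ (γ q , 0#) D.* tilt R E (scaled i) a
    tilt-scale q a = E-scale q a , (begin
      E (scaled i ⊠ (λ x → q ℚ.* a x)) + - E (scaled i) * E (λ x → q ℚ.* a x)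
        ≈⟨ +-cong (trans (E-cong λ x → ℚ-x∙yz≈y∙xz (scaled i x) q (a x)) (E-scale q _)) (*-congˡ (E-scale q a)) ⟩
      γ q * E (scaled i ⊠ a) + - E (scaled i) * (γ q * E a)
        ≈⟨ solve 4 (λ g u n v → g :* u :+ n :* (g :* v) := g :* (u :+ n :* v) :+ con 0 :* v) refl _ _ _ _ ⟩
      γ q * (E (scaled i ⊠ a) + - E (scaled i) * E a) + 0# * E a
        ∎)
    tilt≈ : ∀ a → tilt R E (scaled i) a D.≈ (E a , γ (c i) * proj₂ (tilt R E (h i) a))
    tilt≈ a = refl , (begin
      E (scaled i ⊠ a) + - E (scaled i) * E a
        ≈⟨ +-cong (trans (E-cong λ x → ℚ.*-assoc (c i) (h i x) (a x)) (E-scale (c i) _))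
             (*-congʳ (trans (-‿cong (E-scale (c i) (h i))) (-‿distribʳ-* _ _))) ⟩
      γ (c i) * E (h i ⊠ a) + γ (c i) * - E (h i) * E a
        ≈⟨ solve 4 (λ g u n v → g :* u :+ g :* n :* v := g :* (u :+ n :* v)) refl _ _ _ _ ⟩
      γ (c i) * (E (h i ⊠ a) + - E (h i) * E a)
        ∎)

-- Cumulants as sums over set partitions

module _ (R : CommutativeRing 0ℓ 0ℓ) where
  open CommutativeRing R
  open Algebra.Properties.Semiring.Mult semiring using () renaming (_×_ to _×ᴿ_)

  listSum : {A : Set} → (A → Carrier R) → List A → Carrier R
  listSum f = foldr (λ a s → f a + s) 0#

  -- This is (-1)^l l!, the value of μ(α, 1) for α with l + 1 blocks, taken in `R` so that it is
  -- also available over `Dual R`.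
  signedFactorial : ℕ → Carrier R
  signedFactorial zero    = 1#
  signedFactorial (suc l) = - (suc l ×ᴿ signedFactorial l)

  blockProduct : {I X : Set} → ((X → ℚ) → Carrier R) → (I → X → ℚ) → SetPartition I → Carrier R
  blockProduct E h α = List⁺.foldr₁ _*_ (List⁺.map (E ∘ block h) α)

  partitionTerm : {I X : Set} → ((X → ℚ) → Carrier R) → (I → X → ℚ) → SetPartition I → Carrier R
  partitionTerm E h α = signedFactorial (ℓ α ∸ 1) * blockProduct E h α

module _ {R : CommutativeRing 0ℓ 0ℓ} where
  open CommutativeRing R
  open Relation.Binary.Reasoning.Setoid setoid

  listSum-cong : {A : Set} {f g : A → Carrier R} → (∀ a → f a ≈ g a) → ∀ xs → listSum R f xs ≈ listSum R g xs
  listSum-cong f≈g []       = refl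
  listSum-cong f≈g (x ∷ xs) = +-cong (f≈g x) (listSum-cong f≈g xs)

  listSum-map : {A B : Set} (f : B → Carrier R) (g : A → B) → ∀ xs → listSum R f (map g xs) ≡ listSum R (f ∘ g) xs
  listSum-map f g []       = ≡.refl
  listSum-map f g (x ∷ xs) = ≡.cong (f (g x) +_) (listSum-map f g xs)

  *-distribˡ-listSum : {A : Set} (c : Carrier R) (f : A → Carrier R) → ∀ xs → c * listSum R f xs ≈ listSum R (λ a → c * f a) xs
  *-distribˡ-listSum c f []       = zeroʳ c
  *-distribˡ-listSum c f (x ∷ xs) = trans (distribˡ c _ _) (+-congˡ (*-distribˡ-listSum c f xs))

  listSum-++ : {A : Set} (f : A → Carrier R) → ∀ xs ys → listSum R f (xs ++ ys) ≈ listSum R f xs + listSum R f ys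
  listSum-++ f []       ys = sym (+-identityˡ _)
  listSum-++ f (x ∷ xs) ys = trans (+-congˡ (listSum-++ f xs ys)) (sym (+-assoc _ _ _))

  listSum-concatMap : {A B : Set} (f : B → Carrier R) (g : A → List B) → ∀ xs →
                      listSum R f (concatMap g xs) ≈ listSum R (listSum R f ∘ g) xs
  listSum-concatMap f g []       = refl
  listSum-concatMap f g (x ∷ xs) = trans (listSum-++ f (g x) _) (+-congˡ (listSum-concatMap f g xs))

proj₂-listSum : ∀ {R} {A : Set} (f : A → Carrier (Dual R)) → ∀ xs →
                proj₂ (listSum (Dual R) f xs) ≡ listSum R (proj₂ ∘ f) xs
proj₂-listSum     f []       = ≡.refl
proj₂-listSum {R} f (x ∷ xs) = ≡.cong (CommutativeRing._+_ R (proj₂ (f x))) (proj₂-listSum {R} f xs)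

module _ (R : CommutativeRing 0ℓ 0ℓ) where
  open CommutativeRing R
  open Algebra.Properties.Ring ring using (-0#≈0#)
  open Algebra.Properties.Semiring.Mult semiring using () renaming (_×_ to _×ᴿ_)
  open Algebra.Properties.Semiring.Mult (CommutativeRing.semiring (Dual R)) using () renaming (_×_ to _×ᴰ_)

  proj₁-× : ∀ n a → proj₁ (n ×ᴰ a) ≡ n ×ᴿ proj₁ a
  proj₁-× zero    a = ≡.refl
  proj₁-× (suc n) a = ≡.cong (proj₁ a +_) (proj₁-× n a)

  proj₂-× : ∀ n a → proj₂ (n ×ᴰ a) ≡ n ×ᴿ proj₂ a
  proj₂-× zero    a = ≡.refl
  proj₂-× (suc n) a = ≡.cong (proj₂ a +_) (proj₂-× n a)

  ×-zero : ∀ n {a} → a ≈ 0# → n ×ᴿ a ≈ 0#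
  ×-zero zero    a≈0 = refl
  ×-zero (suc n) a≈0 = trans (+-cong a≈0 (×-zero n a≈0)) (+-identityˡ 0#)

  signedFactorial-dual₁ : ∀ l → proj₁ (signedFactorial (Dual R) l) ≡ signedFactorial R l
  signedFactorial-dual₁ zero    = ≡.refl
  signedFactorial-dual₁ (suc l) = ≡.cong -_ (≡.trans
    (proj₁-× (suc l) (signedFactorial (Dual R) l)) (≡.cong (suc l ×ᴿ_) (signedFactorial-dual₁ l)))

  -- Integers are constants of the dual numbers.
  signedFactorial-dual₂ : ∀ l → proj₂ (signedFactorial (Dual R) l) ≈ 0#
  signedFactorial-dual₂ zero    = refl
  signedFactorial-dual₂ (suc l) = trans (-‿cong (trans
    (reflexive (proj₂-× (suc l) (signedFactorial (Dual R) l))) (×-zero (suc l) (signedFactorial-dual₂ l)))) -0#≈0#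

module _ {I X : Set} (h : I → X → ℚ) where

  -- Unlike `blockProduct`, this makes sense for the empty list, where inductions over the blocks
  -- start.
  listProduct : ∀ (R : CommutativeRing 0ℓ 0ℓ) → ((X → ℚ) → Carrier R) → List (List⁺ I) → Carrier R
  listProduct R E = foldr (λ B p → E (block h B) * p) 1#
    where open CommutativeRing R

  blockProduct≈listProduct : ∀ R (E : (X → ℚ) → Carrier R) B Bs →
    R [ blockProduct R E h (B ∷ Bs) ≈ listProduct R E (B ∷ Bs) ]
  blockProduct≈listProduct R E B []       = sym (*-identityʳ _)
    where open CommutativeRing R
  blockProduct≈listProduct R E B (C ∷ Bs) = *-congˡ (blockProduct≈listProduct R E C Bs)
    where open CommutativeRing R

  module _ {R : CommutativeRing 0ℓ 0ℓ} {E : (X → ℚ) → Carrier R} (E-exp : IsExpectation R E) (i : I) where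
    open CommutativeRing R
    open IsExpectation E-exp
    open Algebra.Properties.Semiring.Mult semiring
      using (×-congʳ; ×-assoc-*; ×-comm-*) renaming (_×_ to _×ᴿ_)
    open Algebra.Properties.Ring ring using (-‿distribˡ-*; -‿distribʳ-*)
    open Algebra.Properties.CommutativeSemigroup *-commutativeSemigroup using (x∙yz≈y∙xz)
    open Relation.Binary.Reasoning.Setoid setoid
    open SemiringSolver commutativeSemiring using (solve; _:=_; _:+_; _:*_; con)
    private
      D  = Dual R
      E′ = tilt R E (h i)
      Π′ = listProduct D E′

    proj₁-listProduct : ∀ Bs → proj₁ (Π′ Bs) ≡ listProduct R E Bs
    proj₁-listProduct []       = ≡.refl
    proj₁-listProduct (B ∷ Bs) = ≡.cong (E (block h B) *_) (proj₁-listProduct Bs)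

    insertions : List (List⁺ I) → Carrier R
    insertions Bs = listSum R (listProduct R E ∘ List⁺.toList) (insertInBlock i Bs)

    insertions-∷ : ∀ B Bs → insertions (B ∷ Bs) ≈ E (h i ⊠ block h B) * listProduct R E Bs + E (block h B) * insertions Bs
    insertions-∷ B Bs = +-congˡ (trans (reflexive (listSum-map {R} (listProduct R E ∘ List⁺.toList) (B ∷⁺_) (insertInBlock i Bs)))
      (sym (*-distribˡ-listSum {R} (E (block h B)) (listProduct R E ∘ List⁺.toList) (insertInBlock i Bs))))

    -- The weight depends on the number of blocks only, which insertion keeps.
    insertions-weighted : ∀ (w : ℕ → Carrier R) Bs →
      listSum R (λ β → w (ℓ β) * listProduct R E (List⁺.toList β)) (insertInBlock i Bs) ≈ w (length Bs) * insertions Bs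
    insertions-weighted w []       = sym (zeroʳ _)
    insertions-weighted w (B ∷ Bs) = begin
      w (suc (length Bs)) * (e′ * p) + listSum R (λ β → w (ℓ β) * Πᴸ β) (map (B ∷⁺_) ins)
        ≈⟨ +-congˡ (reflexive (listSum-map {R} (λ β → w (ℓ β) * Πᴸ β) (B ∷⁺_) ins)) ⟩
      w (suc (length Bs)) * (e′ * p) + listSum R (λ β → w (suc (ℓ β)) * (e * Πᴸ β)) ins
        ≈⟨ +-congˡ (listSum-cong {R} (λ β → x∙yz≈y∙xz (w (suc (ℓ β))) e (Πᴸ β)) ins) ⟩
      w (suc (length Bs)) * (e′ * p) + listSum R (λ β → e * (w (suc (ℓ β)) * Πᴸ β)) ins
        ≈⟨ +-congˡ (sym (*-distribˡ-listSum {R} e (λ β → w (suc (ℓ β)) * Πᴸ β) ins)) ⟩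
      w (suc (length Bs)) * (e′ * p) + e * listSum R (λ β → w (suc (ℓ β)) * Πᴸ β) ins
        ≈⟨ +-congˡ (*-congˡ (insertions-weighted (w ∘ suc) Bs)) ⟩
      w (suc (length Bs)) * (e′ * p) + e * (w (suc (length Bs)) * insertions Bs)
        ≈⟨ solve 4 (λ w q e n → w :* q :+ e :* (w :* n) := w :* (q :+ e :* n)) refl
             (w (suc (length Bs))) (e′ * p) e (insertions Bs) ⟩
      w (suc (length Bs)) * (e′ * p + e * insertions Bs)
        ≈⟨ *-congˡ (sym (insertions-∷ B Bs)) ⟩
      w (suc (length Bs)) * insertions (B ∷ Bs)
        ∎
      where
      ins = insertInBlock i Bs
      Πᴸ  = listProduct R E ∘ List⁺.toList
      e   = E (block h B)
      e′  = E (h i ⊠ block h B)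
      p   = listProduct R E Bs

    -- The product rule, with ε-part E[xB] - E[x]E[B] for a block B and x = `h i`. The first terms
    -- insert `i` into each block in turn; the second ones give -E[x] times the whole product, once
    -- per block.
    proj₂-listProduct : ∀ Bs → proj₂ (Π′ Bs) ≈ insertions Bs + length Bs ×ᴿ (- E (h i) * listProduct R E Bs)
    proj₂-listProduct []       = sym (+-identityˡ 0#)
    proj₂-listProduct (B ∷ Bs) = begin
      e * proj₂ (Π′ Bs) + (e′ + n * e) * proj₁ (Π′ Bs)
        ≈⟨ +-cong (*-congˡ (proj₂-listProduct Bs)) (*-congˡ (reflexive (proj₁-listProduct Bs))) ⟩
      e * (insertions Bs + length Bs ×ᴿ (n * p)) + (e′ + n * e) * p
        ≈⟨ solve 6 (λ e i l e′ n p → e :* (i :+ l) :+ (e′ :+ n :* e) :* p :=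
                                     (e′ :* p :+ e :* i) :+ (n :* (e :* p) :+ e :* l)) refl _ _ _ _ _ _ ⟩
      (e′ * p + e * insertions Bs) + (n * (e * p) + e * (length Bs ×ᴿ (n * p)))
        ≈⟨ +-cong (sym (insertions-∷ B Bs)) (+-congˡ (trans (×-comm-* (length Bs) _ _)
             (×-congʳ (length Bs) (x∙yz≈y∙xz e n p)))) ⟩
      insertions (B ∷ Bs) + suc (length Bs) ×ᴿ (n * (e * p))
        ∎
      where
      e  = E (block h B)
      e′ = E (h i ⊠ block h B)
      n  = - E (h i)
      p  = listProduct R E Bs

    -- If `α` has l + 1 blocks, adding {i} as a new block multiplies the weight by -(l + 1). This
    -- accounts for the l + 1 corrections by -E[h i] in the product rule, and the insertions account
    -- for the rest.
    partitionTerm-tilt : ∀ α →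
      listSum R (partitionTerm R E h) ((List⁺.[ i ] ∷⁺ α) ∷ insertInBlock i (List⁺.toList α)) ≈
      proj₂ (partitionTerm D E′ h α)
    partitionTerm-tilt α@(B ∷ Bs) = begin
      w (suc l) * (E (block h List⁺.[ i ]) * blockProduct R E h α) + listSum R (partitionTerm R E h) ins
        ≈⟨ +-cong (*-congˡ (*-cong (E-cong λ x → ℚ.*-identityʳ (h i x)) (blockProduct≈listProduct R E B Bs)))
             (trans (listSum-cong {R} (λ (C ∷ Cs) → *-congˡ (blockProduct≈listProduct R E C Cs)) ins)
                    (insertions-weighted (λ m → w (m ∸ 1)) (B ∷ Bs))) ⟩
      - (suc l ×ᴿ w l) * (E (h i) * p) + w l * insertions (B ∷ Bs)
        ≈⟨ +-congʳ (begin
             - (suc l ×ᴿ w l) * (E (h i) * p)      ≈⟨ -‿distribˡ-* _ _ ⟨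
             - (suc l ×ᴿ w l * (E (h i) * p))      ≈⟨ -‿distribʳ-* _ _ ⟩
             suc l ×ᴿ w l * - (E (h i) * p)        ≈⟨ ×-assoc-* (suc l) _ _ ⟩
             suc l ×ᴿ (w l * - (E (h i) * p))      ≈⟨ ×-comm-* (suc l) _ _ ⟨
             w l * suc l ×ᴿ (- (E (h i) * p))      ≈⟨ *-congˡ (×-congʳ (suc l) (-‿distribˡ-* _ _)) ⟩
             w l * suc l ×ᴿ (- E (h i) * p)        ∎) ⟩
      w l * suc l ×ᴿ (- E (h i) * p) + w l * insertions (B ∷ Bs)
        -- The summand `con 0 :* q` is the half of the product rule in `Dual R` that differentiates
        -- the weight.
        ≈⟨ solve 4 (λ w m i q → w :* m :+ w :* i := w :* (i :+ m) :+ con 0 :* q) refl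
             _ _ _ (proj₁ (blockProduct D E′ h α)) ⟩
      w l * (insertions (B ∷ Bs) + suc l ×ᴿ (- E (h i) * p)) + 0# * proj₁ (blockProduct D E′ h α)
        ≈⟨ +-cong (*-cong (reflexive (signedFactorial-dual₁ R l))
             (trans (proj₂ (blockProduct≈listProduct D E′ B Bs)) (proj₂-listProduct (B ∷ Bs)))) (*-congʳ (signedFactorial-dual₂ R l)) ⟨
      proj₂ (partitionTerm D E′ h α)
        ∎
      where
      l   = length Bs
      w   = signedFactorial R
      p   = listProduct R E (B ∷ Bs)
      ins = insertInBlock i (B ∷ Bs)

  -- `setPartitions` and `κ` follow the same recursion. Grouped by what remains after removing `i`,
  -- the terms sum to the ε-part of one term for the tilted expectation.
  κ-setPartitions : ∀ {R} {E : (X → ℚ) → Carrier R} → IsExpectation R E → ∀ i is →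
    R [ listSum R (partitionTerm R E h) (setPartitions i is) ≈ κ R E h i is ]
  κ-setPartitions {R} E-exp i [] = trans (+-identityʳ _) (trans (*-identityˡ _) (E-cong λ x → ℚ.*-identityʳ (h i x)))
    where
    open CommutativeRing R
    open IsExpectation E-exp
  κ-setPartitions {R} {E} E-exp i (j ∷ js) = begin
    listSum R (partitionTerm R E h) (setPartitions i (j ∷ js))
      ≈⟨ listSum-concatMap {R} (partitionTerm R E h)
           (λ α → (List⁺.[ i ] ∷⁺ α) ∷ insertInBlock i (List⁺.toList α)) (setPartitions j js) ⟩
    listSum R (λ α → listSum R (partitionTerm R E h) ((List⁺.[ i ] ∷⁺ α) ∷ insertInBlock i (List⁺.toList α))) (setPartitions j js)
      ≈⟨ listSum-cong {R} (partitionTerm-tilt E-exp i) (setPartitions j js) ⟩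
    listSum R (proj₂ ∘ partitionTerm (Dual R) (tilt R E (h i)) h) (setPartitions j js)
      ≈⟨ reflexive (proj₂-listSum {R} (partitionTerm (Dual R) (tilt R E (h i)) h) (setPartitions j js)) ⟨
    proj₂ (listSum (Dual R) (partitionTerm (Dual R) (tilt R E (h i)) h) (setPartitions j js))
      ≈⟨ proj₂ (κ-setPartitions (tilt-isExpectation E-exp (h i)) j js) ⟩
    κ R E h i (j ∷ js)
      ∎
    where
    open CommutativeRing R
    open Relation.Binary.Reasoning.Setoid setoid

open import Data.Rational.Base using (_+_; _-_; _*_; -_)
open import Relation.Binary.PropositionalEquality using (refl; sym; trans; cong; cong₂; module ≡-Reasoning)

-- The embedding of ℤ into ℚ

fromℤ : ℤ → ℚ
fromℤ i = i / 1

toℚᵘ-fromℤ : ∀ i → toℚᵘ (fromℤ i) ℚᵘ.≃ (i ℚᵘ./ 1)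
toℚᵘ-fromℤ i = ℚ.toℚᵘ-fromℚᵘ (i ℚᵘ./ 1)

fromℤ-* : ∀ i j → fromℤ (i ℤ.* j) ≡ fromℤ i * fromℤ j
fromℤ-* i j = ℚ.toℚᵘ-injective (begin
  toℚᵘ (fromℤ (i ℤ.* j))                ≈⟨ toℚᵘ-fromℤ (i ℤ.* j) ⟩
  (i ℚᵘ./ 1) ℚᵘ.* (j ℚᵘ./ 1)            ≈⟨ ℚᵘ.*-cong (toℚᵘ-fromℤ i) (toℚᵘ-fromℤ j) ⟨
  toℚᵘ (fromℤ i) ℚᵘ.* toℚᵘ (fromℤ j)    ≈⟨ ℚ.toℚᵘ-homo-* (fromℤ i) (fromℤ j) ⟨
  toℚᵘ (fromℤ i * fromℤ j)              ∎)
  where open ℚᵘ.≃-Reasoning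

fromℤ-+ : ∀ i j → fromℤ (i ℤ.+ j) ≡ fromℤ i + fromℤ j
fromℤ-+ i j = ℚ.toℚᵘ-injective (begin
  toℚᵘ (fromℤ (i ℤ.+ j))                ≈⟨ toℚᵘ-fromℤ (i ℤ.+ j) ⟩
  (i ℤ.+ j) ℚᵘ./ 1                      ≡⟨ cong (ℚᵘ._/ 1) (cong₂ ℤ._+_ (ℤ.*-identityʳ i) (ℤ.*-identityʳ j)) ⟨
  (i ℚᵘ./ 1) ℚᵘ.+ (j ℚᵘ./ 1)            ≈⟨ ℚᵘ.+-cong (toℚᵘ-fromℤ i) (toℚᵘ-fromℤ j) ⟨
  toℚᵘ (fromℤ i) ℚᵘ.+ toℚᵘ (fromℤ j)    ≈⟨ ℚ.toℚᵘ-homo-+ (fromℤ i) (fromℤ j) ⟨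
  toℚᵘ (fromℤ i + fromℤ j)              ∎)
  where open ℚᵘ.≃-Reasoning

fromℕ-+ : ∀ m n → fromℕ (m ℕ.+ n) ≡ fromℕ m + fromℕ n
fromℕ-+ m n = fromℤ-+ (ℤ.+ m) (ℤ.+ n)

fromℕ-* : ∀ m n → fromℕ (m ℕ.* n) ≡ fromℕ m * fromℕ n
fromℕ-* m n = trans (cong fromℤ (ℤ.pos-* m n)) (fromℤ-* (ℤ.+ m) (ℤ.+ n))

-- The commutative ring of power series

·-zeroʳ : ∀ F → F · const 0ℚ ≗ const 0ℚ
·-zeroʳ F []       = ℚ.*-zeroʳ (F [])
·-zeroʳ F (r ∷ rs) = trans (sum-cong-≗ {suc r} λ i → ·-zeroʳ (F ∘ (toℕ i ∷_)) rs) (sum-replicate-zero (suc r))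

∑-reverse : ∀ r (a : ℕ → ℕ → ℚ) → ∑[ i ≤ r ] a (toℕ i) (r ∸ toℕ i) ≡ ∑[ i ≤ r ] a (r ∸ toℕ i) (toℕ i)
∑-reverse r a = trans (sum-permute (λ i → a (toℕ i) (r ∸ toℕ i)) (Permutation.reverse {suc r}))
  (sum-cong-≗ {suc r} λ i → cong₂ a (Fin.opposite-prop i)
    (trans (cong (r ∸_) (Fin.opposite-prop i)) (ℕ.m∸[m∸n]≡n (Fin.toℕ≤pred[n] i))))

·-comm : ∀ F G → F · G ≗ G · F
·-comm F G []       = ℚ.*-comm (F []) (G [])
·-comm F G (r ∷ rs) = trans
  (sum-cong-≗ {suc r} λ i → ·-comm (F ∘ (toℕ i ∷_)) (G ∘ (r ∸ toℕ i ∷_)) rs)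
  (∑-reverse r λ i j → ((G ∘ (j ∷_)) · (F ∘ (i ∷_))) rs)

·-distribˡ-+ : ∀ F G H → F · (G ⊞ H) ≗ (F · G) ⊞ (F · H)
·-distribˡ-+ F G H []       = ℚ.*-distribˡ-+ (F []) (G []) (H [])
·-distribˡ-+ F G H (r ∷ rs) = trans
  (sum-cong-≗ {suc r} λ i → ·-distribˡ-+ (F ∘ (toℕ i ∷_)) (G ∘ (r ∸ toℕ i ∷_)) (H ∘ (r ∸ toℕ i ∷_)) rs)
  (∑-distrib-+ {suc r} (λ i → ((F ∘ (toℕ i ∷_)) · (G ∘ (r ∸ toℕ i ∷_))) rs)
                       (λ i → ((F ∘ (toℕ i ∷_)) · (H ∘ (r ∸ toℕ i ∷_))) rs))

powerSeriesRing : CommutativeRing 0ℓ 0ℓ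
powerSeriesRing = record
  { Carrier = PowerSeries
  ; _≈_     = _≗_
  ; _+_     = _⊞_
  ; _*_     = _·_
  ; -_      = λ F rs → - F rs
  ; 0#      = const 0ℚ
  ; 1#      = one
  ; isCommutativeRing = record
    { isRing = record
      { +-isAbelianGroup = record
        { isGroup = record
          { isMonoid = record
            { isSemigroup = record
              { isMagma = record
                { isEquivalence = record
                  { refl  = λ _ → refl
                  ; sym   = λ F≗G rs → sym (F≗G rs)
                  ; trans = λ F≗G G≗H rs → trans (F≗G rs) (G≗H rs)
                  }
                ; ∙-cong = λ F≗ G≗ rs → cong₂ _+_ (F≗ rs) (G≗ rs)
                }
              ; assoc = λ F G H rs → ℚ.+-assoc (F rs) (G rs) (H rs)
              }
            ; identity = (λ F rs → ℚ.+-identityˡ (F rs)) , (λ F rs → ℚ.+-identityʳ (F rs))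
            }
          ; inverse = (λ F rs → ℚ.+-inverseˡ (F rs)) , (λ F rs → ℚ.+-inverseʳ (F rs))
          ; ⁻¹-cong = λ F≗ rs → cong -_ (F≗ rs)
          }
        ; comm = λ F G rs → ℚ.+-comm (F rs) (G rs)
        }
      ; *-cong     = ·-cong
      ; *-assoc    = ·-assoc
      ; *-identity = one·F≗F , λ F rs → trans (·-comm F one rs) (one·F≗F F rs)
      ; distrib    = ·-distribˡ-+ , λ F G H rs → trans (·-comm (G ⊞ H) F rs)
          (trans (·-distribˡ-+ F G H rs) (cong₂ _+_ (·-comm F G rs) (·-comm F H rs)))
      }
    ; *-comm = ·-comm
    }
  }

private
  module PS where
    open CommutativeRing powerSeriesRing public
    open Algebra.Properties.CommutativeSemigroup *-commutativeSemigroup public using (x∙yz≈y∙xz)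
    open Algebra.Properties.Semiring.Exp semiring public using (_^_)
  module PS-solver = SemiringSolver PS.commutativeSemiring

-- Constant series and the Möbius weights

scale : ℚ → PowerSeries
scale c rs = c * one rs

·-scaleˡ : ∀ c F G → (λ s → c * F s) · G ≗ λ s → c * (F · G) s
·-scaleˡ c F G []       = ℚ.*-assoc c (F []) (G [])
·-scaleˡ c F G (s ∷ ss) = trans
  (sum-cong-≗ {suc s} λ i → ·-scaleˡ c (F ∘ (toℕ i ∷_)) (G ∘ (s ∸ toℕ i ∷_)) ss)
  (sym (*-distribˡ-sum {suc s} c λ i → ((F ∘ (toℕ i ∷_)) · (G ∘ (s ∸ toℕ i ∷_))) ss))

scale·F : ∀ c F → scale c · F ≗ λ rs → c * F rs
scale·F c F rs = trans (·-scaleˡ c one F rs) (cong (c *_) (one·F≗F F rs))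

·-scaleʳ : ∀ c F G → F · (λ s → c * G s) ≗ λ s → c * (F · G) s
·-scaleʳ c F G rs = trans (·-comm F (λ s → c * G s) rs) (trans (·-scaleˡ c G F rs) (cong (c *_) (·-comm G F rs)))

scale-* : ∀ c d → scale (c * d) ≗ scale c · scale d
scale-* c d rs = trans (ℚ.*-assoc c d (one rs)) (sym (scale·F c (scale d) rs))

scale-1 : scale 1ℚ ≗ one
scale-1 rs = ℚ.*-identityˡ (one rs)

-- `F` does not involve u₁, so in the Cauchy product only its coefficient with exponent 0
-- contributes.
·-at : ∀ {F G} r rs → (∀ i s → F (suc i ∷ s) ≡ 0ℚ) → (F · G) (r ∷ rs) ≡ ((F ∘ (0 ∷_)) · (G ∘ (r ∷_))) rs
·-at {F} {G} r rs F≡0 = trans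
  (cong (((F ∘ (0 ∷_)) · (G ∘ (r ∷_))) rs +_) (trans (sum-cong-≗ {r} vanishing) (sum-replicate-zero r)))
  (ℚ.+-identityʳ _)
  where
  vanishing : ∀ (i : Fin r) → ((F ∘ (suc (toℕ i) ∷_)) · (G ∘ (r ∸ suc (toℕ i) ∷_))) rs ≡ 0ℚ
  vanishing i = trans (·-cong (F≡0 (toℕ i)) (λ _ → refl) rs) (·-zeroˡ (G ∘ (r ∸ suc (toℕ i) ∷_)) rs)

-- For `l` equal to `ℓ α ∸ 1` the scalar is `möbius α`: the weights of the cumulant expansion are
-- those of the connected product.
signedFactorial-scale : ∀ l → signedFactorial powerSeriesRing l ≗ scale ((-1ℤ ℤ.^ l ℤ.* ℤ.+ (l !)) / 1)
signedFactorial-scale zero    rs = sym (ℚ.*-identityˡ (one rs))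
signedFactorial-scale (suc l) rs = begin
  - (suc l ×ᴾ signedFactorial powerSeriesRing l) rs  ≡⟨ cong -_ (×-at (suc l) (signedFactorial powerSeriesRing l) rs) ⟩
  - (fromℕ (suc l) * signedFactorial powerSeriesRing l rs) ≡⟨ cong (λ x → - (fromℕ (suc l) * x)) (signedFactorial-scale l rs) ⟩
  - (fromℕ (suc l) * (fromℤ μ * one rs))             ≡⟨ cong -_ (ℚ.*-assoc (fromℕ (suc l)) (fromℤ μ) (one rs)) ⟨
  - (fromℕ (suc l) * fromℤ μ * one rs)               ≡⟨ ℚ.neg-distribˡ-* (fromℕ (suc l) * fromℤ μ) (one rs) ⟩
  - (fromℕ (suc l) * fromℤ μ) * one rs               ≡⟨ cong (_* one rs) step ⟩
  fromℤ (-1ℤ ℤ.^ suc l ℤ.* ℤ.+ (suc l !)) * one rs   ∎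
  where
  open ≡-Reasoning
  open Algebra.Properties.Semiring.Mult PS.semiring using () renaming (_×_ to _×ᴾ_)
  μ : ℤ
  μ = -1ℤ ℤ.^ l ℤ.* ℤ.+ (l !)
  ×-at : ∀ n F rs → (n ×ᴾ F) rs ≡ fromℕ n * F rs
  ×-at zero    F rs = sym (ℚ.*-zeroˡ (F rs))
  ×-at (suc n) F rs = trans (cong₂ _+_ (sym (ℚ.*-identityˡ (F rs))) (×-at n F rs))
    (trans (sym (ℚ.*-distribʳ-+ (F rs) 1ℚ (fromℕ n))) (cong (_* F rs) (sym (fromℕ-+ 1 n))))
  step : - (fromℕ (suc l) * fromℤ μ) ≡ fromℤ (-1ℤ ℤ.^ suc l ℤ.* ℤ.+ (suc l !))
  step = begin
    - (fromℕ (suc l) * fromℤ μ)               ≡⟨ cong -_ (fromℤ-* (ℤ.+ suc l) μ) ⟨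
    - fromℤ (ℤ.+ suc l ℤ.* μ)                 ≡⟨ cong -_ (ℚ.*-identityˡ (fromℤ (ℤ.+ suc l ℤ.* μ))) ⟨
    - (1ℚ * fromℤ (ℤ.+ suc l ℤ.* μ))          ≡⟨ ℚ.neg-distribˡ-* 1ℚ (fromℤ (ℤ.+ suc l ℤ.* μ)) ⟩
    fromℤ -1ℤ * fromℤ (ℤ.+ suc l ℤ.* μ)       ≡⟨ fromℤ-* -1ℤ (ℤ.+ suc l ℤ.* μ) ⟨
    fromℤ (-1ℤ ℤ.* (ℤ.+ suc l ℤ.* μ))         ≡⟨ cong fromℤ int ⟩
    fromℤ (-1ℤ ℤ.^ suc l ℤ.* ℤ.+ (suc l !))   ∎
    where
    module ℤ-solver = SemiringSolver ℤ.+-*-commutativeSemiring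
    open ℤ-solver
    int : -1ℤ ℤ.* (ℤ.+ suc l ℤ.* μ) ≡ -1ℤ ℤ.^ suc l ℤ.* ℤ.+ (suc l !)
    int = trans (solve 4 (λ a b c d → a :* (b :* (c :* d)) := a :* c :* (b :* d)) refl -1ℤ (ℤ.+ suc l) (-1ℤ ℤ.^ l) (ℤ.+ (l !)))
                (cong (-1ℤ ℤ.^ suc l ℤ.*_) (sym (ℤ.pos-* (suc l) (l !))))

-- The expectation of an observable, and its behaviour in the first variable

-- `⟨ f ⟩` is `𝔼 (series f)`. Observables are functions of the exponents, which are the
-- multiplicities of a partition.
𝔼 : (Monomial → ℚ) → PowerSeries
𝔼 a = Z⁻¹ · a

𝔼-isExpectation : IsExpectation powerSeriesRing 𝔼
𝔼-isExpectation = record { E-cong = ·-cong (λ _ → refl) ; E-1 = Z⁻¹·Z }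

head : Monomial → ℕ
head []      = 0
head (r ∷ _) = r

tail : Monomial → Monomial
tail []       = []
tail (_ ∷ rs) = rs

-- The coefficients of (1 - u) Σ a(r) u^r.
backward : (ℕ → ℚ) → ℕ → ℚ
backward a zero    = a 0
backward a (suc r) = a (suc r) - a r

backward-cong : ∀ {a b} → a ≗ b → backward a ≗ backward b
backward-cong a≗b zero    = a≗b 0
backward-cong a≗b (suc r) = cong₂ _-_ (a≗b (suc r)) (a≗b r)

-- Σ_r a(r) u₁^r
univariate : (ℕ → ℚ) → PowerSeries
univariate a []       = a 0
univariate a (r ∷ rs) = a r * one rs

univariate-cong : ∀ {a b} → a ≗ b → univariate a ≗ univariate b
univariate-cong a≗b []       = a≗b 0
univariate-cong a≗b (r ∷ rs) = cong (_* one rs) (a≗b r)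

-- F(u₁, u₂, …) becomes F(u₂, u₃, …)
shift : PowerSeries → PowerSeries
shift F []           = F []
shift F (zero  ∷ rs) = F rs
shift F (suc _ ∷ rs) = 0ℚ

shift-isHom : IsHom powerSeriesRing powerSeriesRing shift
shift-isHom = record { cong = shift-cong ; +-homo = shift-+ ; *-homo = shift-· ; -‿homo = shift-neg }
  where
  shift-cong : ∀ {F G} → F ≗ G → shift F ≗ shift G
  shift-cong F≗G []           = F≗G []
  shift-cong F≗G (zero  ∷ rs) = F≗G rs
  shift-cong F≗G (suc _ ∷ rs) = refl
  shift-+ : ∀ F G → shift (F ⊞ G) ≗ shift F ⊞ shift G
  shift-+ F G []           = refl
  shift-+ F G (zero  ∷ rs) = refl
  shift-+ F G (suc _ ∷ rs) = refl
  shift-neg : ∀ F → shift (λ rs → - F rs) ≗ λ rs → - shift F rs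
  shift-neg F []           = refl
  shift-neg F (zero  ∷ rs) = refl
  shift-neg F (suc _ ∷ rs) = refl
  shift-· : ∀ F G → shift (F · G) ≗ shift F · shift G
  shift-· F G []           = refl
  shift-· F G (zero  ∷ rs) = sym (ℚ.+-identityʳ _)
  shift-· F G (suc r ∷ rs) = sym (trans (·-at {shift F} {shift G} (suc r) rs (λ _ _ → refl)) (·-zeroʳ F rs))

-- In u₁ the series `Z⁻¹` is 1 - u₁ times its remaining factors, so two terms of the Cauchy product
-- survive and form the difference.
𝔼-split : ∀ a b r rs → 𝔼 ((a ∘ head) ⊠ (b ∘ tail)) (r ∷ rs) ≡ backward a r * 𝔼 b rs
𝔼-split a b zero    rs = trans (ℚ.+-identityʳ _) (·-scaleʳ (a 0) Z⁻¹ b rs)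
𝔼-split a b (suc r) rs = begin
  (Z⁻¹ · λ s → a (suc r) * b s) rs + (((λ s → - 1ℚ * Z⁻¹ s) · (λ s → a r * b s)) rs + ∑[ i < r ] (const 0ℚ · G i) rs)
    ≡⟨ cong₂ _+_ (·-scaleʳ (a (suc r)) Z⁻¹ b rs) (cong₂ _+_
         (trans (·-scaleˡ (- 1ℚ) Z⁻¹ (λ s → a r * b s) rs) (cong (- 1ℚ *_) (·-scaleʳ (a r) Z⁻¹ b rs)))
         (trans (sum-cong-≗ {r} λ i → ·-zeroˡ (G i) rs) (sum-replicate-zero r))) ⟩
  a (suc r) * 𝔼 b rs + (- 1ℚ * (a r * 𝔼 b rs) + 0ℚ)
    ≡⟨ solve 4 (λ m x y z → x :* z :+ (m :* (y :* z) :+ con 0) := (x :+ m :* y) :* z) refl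
         (- 1ℚ) (a (suc r)) (a r) (𝔼 b rs) ⟩
  (a (suc r) + - 1ℚ * a r) * 𝔼 b rs
    ≡⟨ cong (λ x → (a (suc r) + x) * 𝔼 b rs) (trans (sym (ℚ.neg-distribˡ-* 1ℚ (a r))) (cong -_ (ℚ.*-identityˡ (a r)))) ⟩
  (a (suc r) - a r) * 𝔼 b rs
    ∎
  where
  open ≡-Reasoning
  open ℚ-solver
  G : Fin r → PowerSeries
  G i s = a (r ∸ suc (toℕ i)) * b s

𝔼-head : ∀ a → 𝔼 (a ∘ head) ≗ univariate (backward a)
𝔼-head a []       = ℚ.*-identityˡ (a 0)
𝔼-head a (r ∷ rs) = begin
  𝔼 (a ∘ head) (r ∷ rs)                         ≡⟨ ·-cong {Z⁻¹} (λ _ → refl) (λ s → ℚ.*-identityʳ (a (head s))) (r ∷ rs) ⟨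
  𝔼 ((a ∘ head) ⊠ (const 1ℚ ∘ tail)) (r ∷ rs)   ≡⟨ 𝔼-split a (const 1ℚ) r rs ⟩
  backward a r * 𝔼 (const 1ℚ) rs                ≡⟨ cong (backward a r *_) (Z⁻¹·Z rs) ⟩
  backward a r * one rs                         ∎
  where open ≡-Reasoning

-- The marginal of `𝔼` at the first exponent, in closed form; see `𝔼-head`.
𝔼₁ : (ℕ → ℚ) → PowerSeries
𝔼₁ a = univariate (backward a)

𝔼₁-isExpectation : IsExpectation powerSeriesRing 𝔼₁
𝔼₁-isExpectation = record { E-cong = univariate-cong ∘ backward-cong ; E-1 = 1≗ }
  where
  1≗ : 𝔼₁ (const 1ℚ) ≗ one
  1≗ []           = refl
  1≗ (zero  ∷ rs) = ℚ.*-identityˡ (one rs)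
  1≗ (suc _ ∷ rs) = ℚ.*-zeroˡ (one rs)

-- `Z⁻¹` is a product over the variables. The expectation of a function of the tail must be shifted,
-- as it is a series in u₂, u₃, ... only.
head-tail-independent : Independent powerSeriesRing head tail 𝔼 𝔼₁ (shift ∘ 𝔼)
head-tail-independent = record
  { isExpectation  = 𝔼-isExpectation
  ; isExpectation₁ = 𝔼₁-isExpectation
  ; isExpectation₂ = record
    { E-cong = λ a≗b → IsHom.cong shift-isHom (·-cong (λ _ → refl) a≗b)
    ; E-1    = λ rs → trans (IsHom.cong shift-isHom Z⁻¹·Z rs) (shift-one rs) }
  ; +-homo         = ·-distribˡ-+ Z⁻¹
  ; *-homo         = product
  }
  where
  shift-one : shift one ≗ one
  shift-one []           = refl
  shift-one (zero  ∷ rs) = refl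
  shift-one (suc _ ∷ rs) = refl
  product : ∀ a b → 𝔼 ((a ∘ head) ⊠ (b ∘ tail)) ≗ 𝔼₁ a · shift (𝔼 b)
  product a b []       = trans (ℚ.*-identityˡ _) (cong (a 0 *_) (sym (ℚ.*-identityˡ (b []))))
  product a b (r ∷ rs) = begin
    𝔼 ((a ∘ head) ⊠ (b ∘ tail)) (r ∷ rs)          ≡⟨ 𝔼-split a b r rs ⟩
    backward a r * 𝔼 b rs                         ≡⟨ scale·F (backward a r) (𝔼 b) rs ⟨
    (scale (backward a r) · 𝔼 b) rs               ≡⟨ ·-comm (scale (backward a r)) (𝔼 b) rs ⟩
    (𝔼 b · scale (backward a r)) rs               ≡⟨ ·-at {shift (𝔼 b)} {𝔼₁ a} r rs (λ _ _ → refl) ⟨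
    (shift (𝔼 b) · 𝔼₁ a) (r ∷ rs)                 ≡⟨ ·-comm (shift (𝔼 b)) (𝔼₁ a) (r ∷ rs) ⟩
    (𝔼₁ a · shift (𝔼 b)) (r ∷ rs)                 ∎
    where open ≡-Reasoning

-- Products of block expectations

private
  atZero : ℕ → ℚ
  atZero zero    = 1ℚ
  atZero (suc _) = 0ℚ

  _⋆_ : (ℕ → ℚ) → (ℕ → ℚ) → ℕ → ℚ
  (a ⋆ b) r = ∑[ i ≤ r ] (a (toℕ i) * b (r ∸ toℕ i))

univariate-⋆ : ∀ a b → univariate a · univariate b ≗ univariate (a ⋆ b)
univariate-⋆ a b []       = sym (ℚ.+-identityʳ _)
univariate-⋆ a b (r ∷ rs) = begin
  ∑[ i ≤ r ] ((scale (a (toℕ i)) · scale (b (r ∸ toℕ i))) rs)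
    ≡⟨ sum-cong-≗ {suc r} (λ i → scale-* (a (toℕ i)) (b (r ∸ toℕ i)) rs) ⟨
  ∑[ i ≤ r ] (a (toℕ i) * b (r ∸ toℕ i) * one rs)
    ≡⟨ *-distribʳ-sum {suc r} (one rs) (λ i → a (toℕ i) * b (r ∸ toℕ i)) ⟨
  (a ⋆ b) r * one rs
    ∎
  where open ≡-Reasoning

∑-last : ∀ n (a : ℕ → ℚ) → ∑[ i ≤ n ] a (toℕ i) ≡ ∑[ i < n ] a (toℕ i) + a n
∑-last zero    a = ℚ.+-comm (a 0) 0ℚ
∑-last (suc n) a = trans (cong (a 0 +_) (∑-last n (a ∘ suc))) (sym (ℚ.+-assoc (a 0) _ _))

-- The discrete convolution omits the two end terms of the Cauchy product; they vanish because `ext`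
-- is 0 at 0.
ext-∗ : ∀ f g → ext (f ∗ g) ≗ ext f ⋆ ext g
ext-∗ f g zero    = refl
ext-∗ f g (suc r) = sym (begin
  0ℚ * ext g (suc r) + ∑[ i ≤ r ] term (toℕ i)
    ≡⟨ cong₂ _+_ (ℚ.*-zeroˡ (ext g (suc r))) (∑-last r term) ⟩
  0ℚ + (∑[ i < r ] term (toℕ i) + f (suc r) * ext g (r ∸ r))
    ≡⟨ ℚ.+-identityˡ _ ⟩
  ∑[ i < r ] term (toℕ i) + f (suc r) * ext g (r ∸ r)
    ≡⟨ cong (∑[ i < r ] term (toℕ i) +_) (trans (cong (λ x → f (suc r) * ext g x) (ℕ.n∸n≡0 r)) (ℚ.*-zeroʳ (f (suc r)))) ⟩
  ∑[ i < r ] term (toℕ i) + 0ℚ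
    ≡⟨ ℚ.+-identityʳ _ ⟩
  (f ∗ g) (suc r)
    ∎)
  where
  open ≡-Reasoning
  term : ℕ → ℚ
  term i = f (suc i) * ext g (r ∸ i)

-- The indicator of 0 has generating function 1, so `𝔼₁` turns it into 1 - u₁.
oneMinusU : PowerSeries
oneMinusU = 𝔼₁ atZero

oneMinusU-· : ∀ a → oneMinusU · univariate a ≗ 𝔼₁ a
oneMinusU-· a rs = trans (univariate-⋆ (backward atZero) a rs) (univariate-cong difference rs)
  where
  difference : (backward atZero) ⋆ a ≗ backward a
  difference zero    = trans (ℚ.+-identityʳ _) (ℚ.*-identityˡ (a 0))
  difference (suc r) = cong₂ _+_ (ℚ.*-identityˡ (a (suc r)))
    (trans (cong₂ _+_ (trans (sym (ℚ.neg-distribˡ-* 1ℚ (a r))) (cong -_ (ℚ.*-identityˡ (a r))))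
                      (trans (sum-cong-≗ {r} λ i → ℚ.*-zeroˡ (a (r ∸ suc (toℕ i)))) (sum-replicate-zero r)))
           (ℚ.+-identityʳ _))

-- With value 0 at 0, the special case `∂ f 1 = f 1` is a backward difference as well.
ext-∂ : ∀ f → ext (∂ f) ≗ backward (ext f)
ext-∂ f zero          = refl
ext-∂ f (suc zero)    = sym (ℚ.+-identityʳ (f 1))
ext-∂ f (suc (suc r)) = refl

iterate-∂ : ∀ l f → univariate (ext (iterate ∂ f l)) ≗ oneMinusU PS.^ l · univariate (ext f)
iterate-∂ zero    f = PS.sym (one·F≗F (univariate (ext f)))
iterate-∂ (suc l) f = begin
  univariate (ext (iterate ∂ (∂ f) l))                  ≈⟨ iterate-∂ l (∂ f) ⟩
  oneMinusU PS.^ l · univariate (ext (∂ f))             ≈⟨ ·-cong (λ _ → refl) (PS.trans (univariate-cong (ext-∂ f))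
                                                             (PS.sym (oneMinusU-· (ext f)))) ⟩
  oneMinusU PS.^ l · (oneMinusU · univariate (ext f))   ≈⟨ PS.x∙yz≈y∙xz (oneMinusU PS.^ l) oneMinusU (univariate (ext f)) ⟩
  oneMinusU · (oneMinusU PS.^ l · univariate (ext f))   ≈⟨ ·-assoc oneMinusU (oneMinusU PS.^ l) (univariate (ext f)) ⟨
  oneMinusU PS.^ suc l · univariate (ext f)             ∎
  where open Relation.Binary.Reasoning.Setoid PS.setoid

module _ {I : Set} (f : I → Arith) where

  -- At 0 this relies on blocks being nonempty: an empty product would be 1.
  block-ext : ∀ B → block (ext ∘ f) B ≗ ext (prodArith f B)
  block-ext (i ∷ is) zero    = ℚ.*-zeroˡ (productℚ (map (λ j → ext (f j) 0) is))
  block-ext (i ∷ is) (suc r) = refl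

  -- Every block contributes one factor 1 - u₁. One of them is kept apart, to be absorbed into `𝔼₁`
  -- at the end; the other ℓ - 1 become derivatives in `blockProduct-∂`.
  blockProduct-⊛ : ∀ B Bs → let α = B ∷ Bs in
    blockProduct powerSeriesRing 𝔼₁ (ext ∘ f) α ≗ oneMinusU · (oneMinusU PS.^ length Bs · univariate (ext (⊛ f α)))
  blockProduct-⊛ B [] = begin
    𝔼₁ (block (ext ∘ f) B)                                ≈⟨ univariate-cong (backward-cong (block-ext B)) ⟩
    𝔼₁ (ext (prodArith f B))                              ≈⟨ oneMinusU-· (ext (prodArith f B)) ⟨
    oneMinusU · univariate (ext (prodArith f B))          ≈⟨ ·-cong (λ _ → refl) (one·F≗F (univariate (ext (prodArith f B)))) ⟨
    oneMinusU · (one · univariate (ext (prodArith f B)))  ∎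
    where open Relation.Binary.Reasoning.Setoid PS.setoid
  blockProduct-⊛ B (C ∷ Bs) = begin
    𝔼₁ (block (ext ∘ f) B) · blockProduct powerSeriesRing 𝔼₁ (ext ∘ f) (C ∷ Bs)
      ≈⟨ ·-cong (PS.trans (univariate-cong (backward-cong (block-ext B))) (PS.sym (oneMinusU-· b))) (blockProduct-⊛ C Bs) ⟩
    oneMinusU · univariate b · (oneMinusU · (V · univariate c))
      ≈⟨ solve 4 (λ u v b c → u :* b :* (u :* (v :* c)) := u :* (u :* v :* (b :* c))) (λ _ → refl)
           oneMinusU V (univariate b) (univariate c) ⟩
    oneMinusU · (oneMinusU · V · (univariate b · univariate c))
      ≈⟨ ·-cong (λ _ → refl) (·-cong (λ _ → refl) (PS.trans (univariate-⋆ b c)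
           (univariate-cong λ r → sym (ext-∗ (prodArith f B) (⊛ f (C ∷ Bs)) r)))) ⟩
    oneMinusU · (oneMinusU PS.^ suc (length Bs) · univariate (ext (⊛ f (B ∷ C ∷ Bs))))
      ∎
    where
    open Relation.Binary.Reasoning.Setoid PS.setoid
    open PS-solver
    V : PowerSeries
    V = oneMinusU PS.^ length Bs
    b c : ℕ → ℚ
    b = ext (prodArith f B)
    c = ext (⊛ f (C ∷ Bs))

  blockProduct-∂ : ∀ B Bs → let α = B ∷ Bs in
    blockProduct powerSeriesRing 𝔼₁ (ext ∘ f) α ≗ oneMinusU · univariate (ext (iterate ∂ (⊛ f α) (length Bs)))
  blockProduct-∂ B Bs = PS.trans (blockProduct-⊛ B Bs)
    (·-cong (λ _ → refl) (PS.sym (iterate-∂ (length Bs) (⊛ f (B ∷ Bs)))))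

-- The associated function as a cumulant in one variable

listSum-at : ∀ {A : Set} (F : A → PowerSeries) xs rs →
             listSum powerSeriesRing F xs rs ≡ sumℚ (map (λ a → F a rs) xs)
listSum-at F []       rs = refl
listSum-at F (x ∷ xs) rs = cong (F x rs +_) (listSum-at F xs rs)

univariate-sum : ∀ {A : Set} (c : A → ℚ) (φ : A → Arith) xs →
  univariate (ext (λ m → sumℚ (map (λ a → c a * φ a m) xs))) ≗
  listSum powerSeriesRing (λ a → scale (c a) · univariate (ext (φ a))) xs
univariate-sum c φ xs rs = begin
  univariate (ext (λ m → sumℚ (map (λ a → c a * φ a m) xs))) rs
    ≡⟨ at xs rs ⟩
  sumℚ (map (λ a → c a * univariate (ext (φ a)) rs) xs)
    ≡⟨ cong sumℚ (map-cong (λ a → scale·F (c a) (univariate (ext (φ a))) rs) xs) ⟨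
  sumℚ (map (λ a → (scale (c a) · univariate (ext (φ a))) rs) xs)
    ≡⟨ listSum-at (λ a → scale (c a) · univariate (ext (φ a))) xs rs ⟨
  listSum powerSeriesRing (λ a → scale (c a) · univariate (ext (φ a))) xs rs
    ∎
  where
  open ≡-Reasoning
  ext-at : ∀ r xs → ext (λ m → sumℚ (map (λ a → c a * φ a m) xs)) r ≡ sumℚ (map (λ a → c a * ext (φ a) r) xs)
  ext-at zero    []       = refl
  ext-at zero    (x ∷ xs) = sym (trans (cong₂ _+_ (ℚ.*-zeroʳ (c x)) (sym (ext-at zero xs))) (ℚ.+-identityˡ 0ℚ))
  ext-at (suc r) xs       = refl
  sum-*ʳ : ∀ z (f : _ → ℚ) xs → sumℚ (map f xs) * z ≡ sumℚ (map (λ a → f a * z) xs)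
  sum-*ʳ z f []       = ℚ.*-zeroˡ z
  sum-*ʳ z f (x ∷ xs) = trans (ℚ.*-distribʳ-+ z (f x) _) (cong (f x * z +_) (sum-*ʳ z f xs))
  at : ∀ xs rs → univariate (ext (λ m → sumℚ (map (λ a → c a * φ a m) xs))) rs ≡
                 sumℚ (map (λ a → c a * univariate (ext (φ a)) rs) xs)
  at xs []       = ext-at 0 xs
  at xs (r ∷ rs) = trans (cong (_* one rs) (ext-at r xs)) (trans (sum-*ʳ (one rs) (λ a → c a * ext (φ a) r) xs)
    (cong sumℚ (map-cong (λ a → ℚ.*-assoc (c a) (ext (φ a) r) (one rs)) xs)))

-- The case of one multiplicity. All terms of the set partition expansion share a factor 1 - u₁;
-- taking it out leaves the generating function of `associated f`.
κ-associated : ∀ {n} (f : Fin (suc n) → Arith) →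
               κ powerSeriesRing 𝔼₁ (ext ∘ f) fzero (tabulate fsuc) ≗ 𝔼₁ (ext (associated f))
κ-associated {n} f = begin
  κ powerSeriesRing 𝔼₁ (ext ∘ f) fzero (tabulate fsuc)
    ≈⟨ κ-setPartitions (ext ∘ f) 𝔼₁-isExpectation fzero (tabulate fsuc) ⟨
  listSum powerSeriesRing (partitionTerm powerSeriesRing 𝔼₁ (ext ∘ f)) (Π n)
    ≈⟨ listSum-cong {powerSeriesRing} term (Π n) ⟩
  listSum powerSeriesRing (λ α → oneMinusU · (scale (möbius α) · G α)) (Π n)
    ≈⟨ *-distribˡ-listSum {powerSeriesRing} oneMinusU (λ α → scale (möbius α) · G α) (Π n) ⟨
  oneMinusU · listSum powerSeriesRing (λ α → scale (möbius α) · G α) (Π n)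
    ≈⟨ ·-cong (λ _ → refl) (univariate-sum möbius (λ α → iterate ∂ (⊛ f α) (ℓ α ∸ 1)) (Π n)) ⟨
  oneMinusU · univariate (ext (associated f))
    ≈⟨ oneMinusU-· (ext (associated f)) ⟩
  𝔼₁ (ext (associated f))
    ∎
  where
  open Relation.Binary.Reasoning.Setoid PS.setoid
  G : SetPartition (Fin (suc n)) → PowerSeries
  G α = univariate (ext (iterate ∂ (⊛ f α) (ℓ α ∸ 1)))
  term : ∀ α → partitionTerm powerSeriesRing 𝔼₁ (ext ∘ f) α ≗ oneMinusU · (scale (möbius α) · G α)
  term α@(B ∷ Bs) = begin
    signedFactorial powerSeriesRing (length Bs) · blockProduct powerSeriesRing 𝔼₁ (ext ∘ f) α
      ≈⟨ ·-cong (signedFactorial-scale (length Bs)) (blockProduct-∂ f B Bs) ⟩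
    scale (möbius α) · (oneMinusU · G α)
      ≈⟨ PS.x∙yz≈y∙xz (scale (möbius α)) oneMinusU (G α) ⟩
    oneMinusU · (scale (möbius α) · G α)
      ∎

-- The Euler derivation u₁ ∂/∂u₁
θ : PowerSeries → PowerSeries
θ F = (fromℕ ∘ head) ⊠ F

-- The Leibniz rule, from r = (r - i) + i in each term of the Cauchy product.
θ-· : ∀ F G → θ (F · G) ≗ (F · θ G) ⊞ (θ F · G)
θ-· F G []       = solve 2 (λ f g → con 0 :* (f :* g) := f :* (con 0 :* g) :+ (con 0 :* f) :* g) refl (F []) (G [])
  where open ℚ-solver
θ-· F G (r ∷ rs) = begin
  fromℕ r * ∑[ i ≤ r ] P i
    ≡⟨ *-distribˡ-sum {suc r} (fromℕ r) P ⟩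
  ∑[ i ≤ r ] (fromℕ r * P i)
    ≡⟨ sum-cong-≗ {suc r} (λ i → trans
         (cong (λ x → fromℕ x * P i) (sym (ℕ.m∸n+n≡m (Fin.toℕ≤pred[n] i))))
         (trans (cong (_* P i) (fromℕ-+ (r ∸ toℕ i) (toℕ i)))
         (trans (ℚ.*-distribʳ-+ (P i) (fromℕ (r ∸ toℕ i)) (fromℕ (toℕ i)))
         (cong₂ _+_ (sym (·-scaleʳ (fromℕ (r ∸ toℕ i)) (F ∘ (toℕ i ∷_)) (G ∘ (r ∸ toℕ i ∷_)) rs))
                    (sym (·-scaleˡ (fromℕ (toℕ i)) (F ∘ (toℕ i ∷_)) (G ∘ (r ∸ toℕ i ∷_)) rs)))))) ⟩
  ∑[ i ≤ r ] (((F ∘ (toℕ i ∷_)) · (θ G ∘ (r ∸ toℕ i ∷_))) rs + ((θ F ∘ (toℕ i ∷_)) · (G ∘ (r ∸ toℕ i ∷_))) rs)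
    ≡⟨ ∑-distrib-+ {suc r} (λ i → ((F ∘ (toℕ i ∷_)) · (θ G ∘ (r ∸ toℕ i ∷_))) rs)
                           (λ i → ((θ F ∘ (toℕ i ∷_)) · (G ∘ (r ∸ toℕ i ∷_))) rs) ⟩
  ((F · θ G) ⊞ (θ F · G)) (r ∷ rs)
    ∎
  where
  open ≡-Reasoning
  P : Fin (suc r) → ℚ
  P i = ((F ∘ (toℕ i ∷_)) · (G ∘ (r ∸ toℕ i ∷_))) rs

θ-isHom : IsHom powerSeriesRing (Dual powerSeriesRing) (λ F → F , θ F)
θ-isHom = record
  { cong   = λ F≗G → F≗G , λ rs → cong (fromℕ (head rs) *_) (F≗G rs)
  ; +-homo = λ F G → (λ _ → refl) , λ rs → ℚ.*-distribˡ-+ (fromℕ (head rs)) (F rs) (G rs)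
  ; *-homo = λ F G → (λ _ → refl) , θ-· F G
  ; -‿homo = λ F → (λ _ → refl) , λ rs → sym (ℚ.neg-distribʳ-* (fromℕ (head rs)) (F rs))
  }

Z·Z⁻¹ : Z · Z⁻¹ ≗ one
Z·Z⁻¹ rs = trans (·-comm Z Z⁻¹ rs) (Z⁻¹·Z rs)

Z·𝔼 : ∀ a → Z · 𝔼 a ≗ a
Z·𝔼 a = PS.trans (PS.sym (·-assoc Z Z⁻¹ a)) (PS.trans (·-cong Z·Z⁻¹ (λ _ → refl)) (one·F≗F a))

𝔼-Z· : ∀ F → 𝔼 (Z · F) ≗ F
𝔼-Z· F = PS.trans (PS.sym (·-assoc Z⁻¹ Z F)) (PS.trans (·-cong Z⁻¹·Z (λ _ → refl)) (one·F≗F F))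

-- Differentiating `Z⁻¹ · Z = 1` gives the logarithmic derivative: `Z⁻¹ · θ Z` is the expectation of
-- the first exponent.
θ-Z⁻¹ : θ Z⁻¹ ≗ (λ rs → - 𝔼 (fromℕ ∘ head) rs) · Z⁻¹
θ-Z⁻¹ = begin
  θ Z⁻¹                                     ≈⟨ PS.trans (·-cong (λ _ → refl) Z·Z⁻¹) (PS.*-identityʳ (θ Z⁻¹)) ⟨
  θ Z⁻¹ · (Z · Z⁻¹)                         ≈⟨ ·-assoc (θ Z⁻¹) Z Z⁻¹ ⟨
  θ Z⁻¹ · Z · Z⁻¹                           ≈⟨ ·-cong (inverseʳ-unique (𝔼 (fromℕ ∘ head)) (θ Z⁻¹ · Z) derivative) (λ _ → refl) ⟩
  (λ rs → - 𝔼 (fromℕ ∘ head) rs) · Z⁻¹      ∎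
  where
  open Relation.Binary.Reasoning.Setoid PS.setoid
  open Algebra.Properties.Group PS.+-group using (inverseʳ-unique)
  θ-one : θ one ≗ const 0ℚ
  θ-one []           = refl
  θ-one (zero  ∷ rs) = ℚ.*-zeroˡ (one rs)
  θ-one (suc r ∷ rs) = ℚ.*-zeroʳ (fromℕ (suc r))
  derivative : 𝔼 (fromℕ ∘ head) ⊞ (θ Z⁻¹ · Z) ≗ const 0ℚ
  derivative = begin
    𝔼 (fromℕ ∘ head) ⊞ (θ Z⁻¹ · Z)     ≈⟨ PS.+-congʳ (·-cong (λ _ → refl) λ rs → sym (ℚ.*-identityʳ (fromℕ (head rs)))) ⟩
    (Z⁻¹ · θ Z) ⊞ (θ Z⁻¹ · Z)          ≈⟨ θ-· Z⁻¹ Z ⟨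
    θ (Z⁻¹ · Z)                        ≈⟨ (λ rs → cong (fromℕ (head rs) *_) (Z⁻¹·Z rs)) ⟩
    θ one                              ≈⟨ θ-one ⟩
    const 0ℚ                           ∎

-- Apply the Leibniz rule to `Z⁻¹ · a`: differentiating `a` inserts the factor r₁, and
-- differentiating `Z⁻¹` produces the normalisation -E[r₁]E[a]. The detour through `𝔼` makes `Z⁻¹`
-- appear.
tilt-θ : ∀ a → 𝔼₁ (fromℕ ⊠ a) ⊞ ((λ rs → - 𝔼₁ fromℕ rs) · 𝔼₁ a) ≗ θ (𝔼₁ a)
tilt-θ a = begin
  𝔼₁ (fromℕ ⊠ a) ⊞ ((λ rs → - 𝔼₁ fromℕ rs) · 𝔼₁ a)
    ≈⟨ PS.+-cong (𝔼-head (fromℕ ⊠ a)) (·-cong (λ rs → cong -_ (𝔼-head fromℕ rs)) (𝔼-head a)) ⟨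
  𝔼 (θ (a ∘ head)) ⊞ ((λ rs → - 𝔼 (fromℕ ∘ head) rs) · (Z⁻¹ · (a ∘ head)))
    ≈⟨ PS.+-congˡ {𝔼 (θ (a ∘ head))} (PS.trans
         (PS.sym (·-assoc (λ rs → - 𝔼 (fromℕ ∘ head) rs) Z⁻¹ (a ∘ head))) (·-cong (PS.sym θ-Z⁻¹) λ _ → refl)) ⟩
  (Z⁻¹ · θ (a ∘ head)) ⊞ (θ Z⁻¹ · (a ∘ head))
    ≈⟨ θ-· Z⁻¹ (a ∘ head) ⟨
  θ (𝔼 (a ∘ head))
    ≈⟨ (λ rs → cong (fromℕ (head rs) *_) (𝔼-head a rs)) ⟩
  θ (𝔼₁ a)
    ∎
  where open Relation.Binary.Reasoning.Setoid PS.setoid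

∂-𝔼₁ : ∀ f r → ∂ f (suc r) ≡ 𝔼₁ (ext f) (suc r ∷ [])
∂-𝔼₁ f r = trans (ext-∂ f (suc r)) (sym (ℚ.*-identityʳ _))

-- Both derivatives are coefficients of one-variable cumulants, by `∂-𝔼₁` and `κ-associated`.
-- Tilting by the identity is the homomorphism F ↦ F + εθF, so the longer cumulant is `θ` of the
-- shorter one.
∂-associated : ∀ n (f : Fin (suc (suc n)) → Arith) → IsId (f fzero) →
               ∂ (associated f) ≐ λ m → f fzero m * ∂ (associated (f ∘ fsuc)) m
∂-associated n f f₀≐id (suc r) = begin
  ∂ (associated f) (suc r)
    ≡⟨ ∂-𝔼₁ (associated f) r ⟩
  𝔼₁ (ext (associated f)) (suc r ∷ [])
    ≡⟨ κ-associated f (suc r ∷ []) ⟨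
  κ powerSeriesRing 𝔼₁ (ext ∘ f) fzero (tabulate fsuc) (suc r ∷ [])
    -- On the coefficient of u₁^(r + 1), `θ` is multiplication by r + 1.
    ≡⟨ proj₂ (κ-natural θ-isHom tilt≈ (ext ∘ f) (fsuc fzero) (tabulate (fsuc ∘ fsuc))) (suc r ∷ []) ⟩
  fromℕ (suc r) * κ powerSeriesRing 𝔼₁ (ext ∘ f) (fsuc fzero) (tabulate (fsuc ∘ fsuc)) (suc r ∷ [])
    ≡⟨ cong₂ _*_ (f₀≐id (suc r)) (cong (λ F → F (suc r ∷ [])) (trans
         (κ-reindex powerSeriesRing 𝔼₁ (ext ∘ f) fsuc fzero (tabulate fsuc))
         (cong (κ powerSeriesRing 𝔼₁ (ext ∘ f) (fsuc fzero)) (map-tabulate fsuc fsuc)))) ⟨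
  f fzero (suc r) * κ powerSeriesRing 𝔼₁ (ext ∘ f ∘ fsuc) fzero (tabulate fsuc) (suc r ∷ [])
    ≡⟨ cong (f fzero (suc r) *_) (κ-associated (f ∘ fsuc) (suc r ∷ [])) ⟩
  f fzero (suc r) * 𝔼₁ (ext (associated (f ∘ fsuc))) (suc r ∷ [])
    ≡⟨ cong (f fzero (suc r) *_) (∂-𝔼₁ (associated (f ∘ fsuc)) r) ⟨
  f fzero (suc r) * ∂ (associated (f ∘ fsuc)) (suc r)
    ∎
  where
  open ≡-Reasoning
  ext-id : ext (f fzero) ≗ fromℕ
  ext-id zero    = refl
  ext-id (suc r) = f₀≐id (suc r)
  tilt≈ : ∀ a → Dual powerSeriesRing [ tilt powerSeriesRing 𝔼₁ (ext (f fzero)) a ≈ (𝔼₁ a , θ (𝔼₁ a)) ]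
  tilt≈ a = (λ _ → refl) , PS.trans (PS.+-cong
    (univariate-cong (backward-cong λ r → cong (_* a r) (ext-id r)))
    (·-cong (λ rs → cong -_ (univariate-cong (backward-cong ext-id) rs)) (λ _ → refl))) (tilt-θ a)

-- Power sums as functions of monomials

-- The list holds the multiplicities of m, m + 1, .... A variable starting index is what induction
-- on the list requires.
powerSumFrom : ℕ → ℕ → Arith → Monomial → ℚ
powerSumFrom m k f []       = 0ℚ
powerSumFrom m k f (r ∷ rs) = fromℕ (m ℕ.^ k) * ext f r + powerSumFrom (suc m) k f rs

powerSumFrom-applyUpTo : ∀ k f n m e →
  ∑[ j < n ] (fromℕ ((m ℕ.+ toℕ j) ℕ.^ k) * ext f (e (toℕ j))) ≡ powerSumFrom m k f (applyUpTo e n)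
powerSumFrom-applyUpTo k f zero    m e = refl
powerSumFrom-applyUpTo k f (suc n) m e = cong₂ _+_
  (cong (λ x → fromℕ (x ℕ.^ k) * ext f (e 0)) (ℕ.+-identityʳ m))
  (trans (sum-cong-≗ {n} λ j → cong (λ x → fromℕ (x ℕ.^ k) * ext f (e (suc (toℕ j)))) (ℕ.+-suc m (toℕ j)))
         (powerSumFrom-applyUpTo k f n (suc m) (e ∘ suc)))

powerSum-toMonomial : ∀ k f p → powerSum k f p ≡ powerSumFrom 1 k f (toMonomial p)
powerSum-toMonomial k f p = powerSumFrom-applyUpTo k f ∣ p ∣ 1 (λ i → multiplicity (suc i) p)

powerSumFrom-respects : ∀ k f m → Respects (powerSumFrom m k f)
powerSumFrom-respects k f m []≋[]        = refl
powerSumFrom-respects k f m ([]≋0∷ []≋s) = sym (trans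
  (cong₂ _+_ (ℚ.*-zeroʳ (fromℕ (m ℕ.^ k))) (sym (powerSumFrom-respects k f (suc m) []≋s))) (ℚ.+-identityˡ 0ℚ))
powerSumFrom-respects k f m (0∷≋[] r≋[]) = trans
  (cong₂ _+_ (ℚ.*-zeroʳ (fromℕ (m ℕ.^ k))) (powerSumFrom-respects k f (suc m) r≋[])) (ℚ.+-identityˡ 0ℚ)
powerSumFrom-respects k f m (x ∷≋ r≋s)   = cong (fromℕ (m ℕ.^ k) * ext f x +_) (powerSumFrom-respects k f (suc m) r≋s)

powerSumFrom-split : ∀ m k f →
  powerSumFrom m k f ≗ ((λ r → fromℕ (m ℕ.^ k) * ext f r) ∘ head) ⊞ (powerSumFrom (suc m) k f ∘ tail)
powerSumFrom-split m k f []       = sym (trans (ℚ.+-identityʳ _) (ℚ.*-zeroʳ (fromℕ (m ℕ.^ k))))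
powerSumFrom-split m k f (r ∷ rs) = refl

-- Cumulants of power sums

𝔼₁-scale : ∀ c a → 𝔼₁ (λ r → c * a r) ≗ scale c · 𝔼₁ a
𝔼₁-scale c a = begin
  𝔼₁ (λ r → c * a r)          ≈⟨ 𝔼-head (λ r → c * a r) ⟨
  𝔼 (λ s → c * a (head s))    ≈⟨ ·-scaleʳ c Z⁻¹ (a ∘ head) ⟩
  (λ rs → c * 𝔼 (a ∘ head) rs) ≈⟨ scale·F c (𝔼 (a ∘ head)) ⟨
  scale c · 𝔼 (a ∘ head)      ≈⟨ ·-cong (λ _ → refl) (𝔼-head a) ⟩
  scale c · 𝔼₁ a              ∎
  where open Relation.Binary.Reasoning.Setoid PS.setoid

scale-^ : ∀ {I : Set} m (k : I → ℕ) is →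
          foldr (λ i → scale (fromℕ (m ℕ.^ k i)) ·_) one is ≗ scale (fromℕ (m ℕ.^ sumℕ (map k is)))
scale-^ m k []       rs = sym (scale-1 rs)
scale-^ m k (i ∷ is) = begin
  scale (fromℕ (m ℕ.^ k i)) · foldr (λ i → scale (fromℕ (m ℕ.^ k i)) ·_) one is
    ≈⟨ ·-cong (λ _ → refl) (scale-^ m k is) ⟩
  scale (fromℕ (m ℕ.^ k i)) · scale (fromℕ (m ℕ.^ K))
    ≈⟨ scale-* (fromℕ (m ℕ.^ k i)) (fromℕ (m ℕ.^ K)) ⟨
  scale (fromℕ (m ℕ.^ k i) * fromℕ (m ℕ.^ K))
    ≈⟨ (λ rs → cong (_* one rs) (trans (cong fromℕ (ℕ.^-distribˡ-+-* m (k i) K)) (fromℕ-* (m ℕ.^ k i) (m ℕ.^ K)))) ⟨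
  scale (fromℕ (m ℕ.^ (k i ℕ.+ K)))
    ∎
  where
  open Relation.Binary.Reasoning.Setoid PS.setoid
  K = sumℕ (map k is)

constantTerm-isHom : IsHom powerSeriesRing ℚ-ring (λ F → F [])
constantTerm-isHom = record
  { cong = λ F≗G → F≗G [] ; +-homo = λ _ _ → refl ; *-homo = λ _ _ → refl ; -‿homo = λ _ → refl }

module _ {n} (k : Fin (suc (suc n)) → ℕ) (f : Fin (suc (suc n)) → Arith) where
  private
    K : ℕ
    K = total k
    others : List (Fin (suc (suc n)))
    others = tabulate fsuc

  -- Homogeneity collects the factors m^(k i) into m^K, which is where the exponents add up.
  κ-scaled : ∀ m → κ powerSeriesRing 𝔼₁ (λ i r → fromℕ (m ℕ.^ k i) * ext (f i) r) fzero others ≗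
                   𝔼₁ (λ r → fromℕ (m ℕ.^ K) * ext (associated f) r)
  κ-scaled m = begin
    κ powerSeriesRing 𝔼₁ (λ i r → fromℕ (m ℕ.^ k i) * ext (f i) r) fzero others
      ≈⟨ κ-homogeneous (λ i → fromℕ (m ℕ.^ k i)) (ext ∘ f) powerSeriesRing scale 𝔼₁-isExpectation 𝔼₁-scale fzero others ⟩
    foldr (λ i → scale (fromℕ (m ℕ.^ k i)) ·_) one (tabulate λ i → i) · κ powerSeriesRing 𝔼₁ (ext ∘ f) fzero others
      ≈⟨ ·-cong (PS.trans (scale-^ m k (tabulate λ i → i)) λ rs →
           cong (λ ks → scale (fromℕ (m ℕ.^ sumℕ ks)) rs) (map-tabulate (λ i → i) k)) (κ-associated f) ⟩
    scale (fromℕ (m ℕ.^ K)) · 𝔼₁ (ext (associated f))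
      ≈⟨ 𝔼₁-scale (fromℕ (m ℕ.^ K)) (ext (associated f)) ⟨
    𝔼₁ (λ r → fromℕ (m ℕ.^ K) * ext (associated f) r)
      ∎
    where open Relation.Binary.Reasoning.Setoid PS.setoid

  -- Independence splits off the first exponent, which `κ-scaled` handles; the tail is the same
  -- claim with m + 1, moved to the later variables by `shift`.
  κ-powerSumFrom : ∀ rs m → κ powerSeriesRing 𝔼 (λ i → powerSumFrom m (k i) (f i)) fzero others rs ≡
                            𝔼 (powerSumFrom m K (associated f)) rs
  -- tail [] is [] again, so here the induction would not descend; instead, taking
  -- the constant term is multiplicative, which kills the cumulant.
  κ-powerSumFrom []       m = trans
    (sym (κ-natural constantTerm-isHom {𝔼} (λ _ → refl) (λ i → powerSumFrom m (k i) (f i)) fzero others))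
    (κ-multiplicative ℚ-ring {E = λ a → 𝔼 a []} {λ i → powerSumFrom m (k i) (f i)} {fzero}
      (λ b → trans (cong (1ℚ *_) (ℚ.*-zeroˡ (b []))) (sym (ℚ.*-zeroˡ (1ℚ * b [])))) (fsuc fzero) (tabulate (fsuc ∘ fsuc)))
  κ-powerSumFrom (r ∷ rs) m = begin
    κ powerSeriesRing 𝔼 (λ i → powerSumFrom m (k i) (f i)) fzero others (r ∷ rs)
      ≡⟨ κ-cong powerSeriesRing (·-cong λ _ → refl) (λ i → powerSumFrom-split m (k i) (f i)) fzero others (r ∷ rs) ⟩
    κ powerSeriesRing 𝔼 (λ i → (a i ∘ head) ⊞ (b i ∘ tail)) fzero others (r ∷ rs)
      ≡⟨ κ-additive head-tail-independent a b fzero others (r ∷ rs) ⟩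
    κ powerSeriesRing 𝔼₁ a fzero others (r ∷ rs) + κ powerSeriesRing (shift ∘ 𝔼) b fzero others (r ∷ rs)
      ≡⟨ cong₂ _+_ (κ-scaled m (r ∷ rs)) (trans (κ-natural shift-isHom (λ _ _ → refl) b fzero others (r ∷ rs)) (shifted r)) ⟩
    𝔼₁ c (r ∷ rs) + shift (𝔼 d) (r ∷ rs)
      ≡⟨ Independent.marginal-+ head-tail-independent c d (r ∷ rs) ⟨
    𝔼 ((c ∘ head) ⊞ (d ∘ tail)) (r ∷ rs)
      ≡⟨ ·-cong {Z⁻¹} (λ _ → refl) (powerSumFrom-split m K (associated f)) (r ∷ rs) ⟨
    𝔼 (powerSumFrom m K (associated f)) (r ∷ rs)
      ∎
    where
    open ≡-Reasoning
    a : Fin (suc (suc n)) → ℕ → ℚ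
    a i r = fromℕ (m ℕ.^ k i) * ext (f i) r
    b : Fin (suc (suc n)) → Monomial → ℚ
    b i = powerSumFrom (suc m) (k i) (f i)
    c : ℕ → ℚ
    c r = fromℕ (m ℕ.^ K) * ext (associated f) r
    d : Monomial → ℚ
    d = powerSumFrom (suc m) K (associated f)
    shifted : ∀ r → shift (κ powerSeriesRing 𝔼 b fzero others) (r ∷ rs) ≡ shift (𝔼 d) (r ∷ rs)
    -- A shifted series vanishes at positive exponents of u₁, so the induction hypothesis is used at
    -- exponent 0 only.
    shifted zero    = κ-powerSumFrom rs (suc m)
    shifted (suc _) = refl

  -- The Bernoulli constants drop out for two or more functions. A constant is a variable on a
  -- one-point space, independent of everything; the expectation there is multiplicative, so its
  -- cumulants vanish.
  κ-shifted-powerSum : ∀ (c : Fin (suc (suc n)) → ℚ) →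
    κ powerSeriesRing 𝔼 (λ i rs → c i + powerSumFrom 1 (k i) (f i) rs) fzero others ≗ 𝔼 (powerSumFrom 1 K (associated f))
  κ-shifted-powerSum c = begin
    κ powerSeriesRing 𝔼 (λ i → ((λ _ → c i) ∘ const tt) ⊞ powerSumFrom 1 (k i) (f i)) fzero others
      ≈⟨ κ-additive constants-independent (λ i _ → c i) (λ i → powerSumFrom 1 (k i) (f i)) fzero others ⟩
    κ powerSeriesRing 𝔼₀ (λ i _ → c i) fzero others ⊞ κ powerSeriesRing 𝔼 (λ i → powerSumFrom 1 (k i) (f i)) fzero others
      ≈⟨ PS.+-cong (κ-multiplicative powerSeriesRing {E = 𝔼₀} {λ i _ → c i} {fzero}
                      (λ b → scale-* (c fzero) (b tt)) (fsuc fzero) (tabulate (fsuc ∘ fsuc)))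
                   (λ rs → κ-powerSumFrom rs 1) ⟩
    const 0ℚ ⊞ 𝔼 (powerSumFrom 1 K (associated f))
      ≈⟨ PS.+-identityˡ _ ⟩
    𝔼 (powerSumFrom 1 K (associated f))
      ∎
    where
    open Relation.Binary.Reasoning.Setoid PS.setoid
    𝔼₀ : (⊤ → ℚ) → PowerSeries
    𝔼₀ a = scale (a tt)
    constants-independent : Independent powerSeriesRing (const tt) (λ rs → rs) 𝔼 𝔼₀ 𝔼
    constants-independent = record
      { isExpectation  = 𝔼-isExpectation
      ; isExpectation₁ = record { E-cong = λ a≗b rs → cong (_* one rs) (a≗b tt) ; E-1 = scale-1 }
      ; isExpectation₂ = 𝔼-isExpectation
      ; +-homo         = ·-distribˡ-+ Z⁻¹
      ; *-homo         = λ a b rs → trans (·-scaleʳ (a tt) Z⁻¹ b rs) (sym (scale·F (a tt) (𝔼 b) rs))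
      }

-- The connected product in terms of cumulants

module _ {I : Set} {h : I → PFun} {H : I → Monomial → ℚ}
         (h≡H : ∀ i p → h i p ≡ H i (toMonomial p)) (H-resp : ∀ i → Respects (H i)) where

  block-toMonomial : ∀ B p → prodPFun h B p ≡ block H B (toMonomial p)
  block-toMonomial B p = cong productℚ (map-cong (λ i → h≡H i p) (List⁺.toList B))

  block-respects : ∀ B → Respects (block H B)
  block-respects B r≋s = cong productℚ (map-cong (λ i → H-resp i r≋s) (List⁺.toList B))

  blockProduct-respects : ∀ B Bs → Respects (blockProduct powerSeriesRing 𝔼 H (B ∷ Bs))
  blockProduct-respects B []       = ·-respects Z⁻¹-respects (block-respects B)
  blockProduct-respects B (C ∷ Bs) = ·-respects (·-respects Z⁻¹-respects (block-respects B)) (blockProduct-respects C Bs)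

  -- `_⊙_` divides both factors by `Z` and multiplies the result by `Z`, so in the iterated product
  -- the inner pairs cancel. Partitions and monomials correspond only up to trailing zeros, hence
  -- the appeals to `Respects`.
  ⨀-blockProduct : ∀ B Bs p → ⨀ h (B ∷ Bs) p ≡ (Z · blockProduct powerSeriesRing 𝔼 H (B ∷ Bs)) (toMonomial p)
  ⨀-blockProduct B []       p = trans (block-toMonomial B p) (sym (Z·𝔼 (block H B) (toMonomial p)))
  ⨀-blockProduct B (C ∷ Bs) p = ·-cong {Z} (λ _ → refl) (·-cong
    (·-cong (λ _ → refl) λ rs → trans (block-toMonomial B (fromMonomial rs)) (block-respects B (toMonomial∘fromMonomial rs)))
    (λ rs → trans (·-cong {Z⁻¹} (λ _ → refl) (λ s → trans (⨀-blockProduct C Bs (fromMonomial s))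
               (·-respects (series-respects (const 1ℚ)) (blockProduct-respects C Bs) (toMonomial∘fromMonomial s))) rs)
      (𝔼-Z· W rs))) (toMonomial p)
    where W = blockProduct powerSeriesRing 𝔼 H (C ∷ Bs)

connected-κ : ∀ {n} {h : Fin (suc n) → PFun} {H : Fin (suc n) → Monomial → ℚ} →
              (∀ i p → h i p ≡ H i (toMonomial p)) → (∀ i → Respects (H i)) → ∀ p →
              connected h p ≡ (Z · κ powerSeriesRing 𝔼 H fzero (tabulate fsuc)) (toMonomial p)
connected-κ {n} {h} {H} h≡H H-resp p = begin
  sumℚ (map (λ α → möbius α * ⨀ h α p) (Π n))
    ≡⟨ cong sumℚ (map-cong term (Π n)) ⟩
  sumℚ (map (λ α → (Z · partitionTerm powerSeriesRing 𝔼 H α) t) (Π n))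
    ≡⟨ listSum-at (λ α → Z · partitionTerm powerSeriesRing 𝔼 H α) (Π n) t ⟨
  listSum powerSeriesRing (λ α → Z · partitionTerm powerSeriesRing 𝔼 H α) (Π n) t
    ≡⟨ *-distribˡ-listSum {powerSeriesRing} Z (partitionTerm powerSeriesRing 𝔼 H) (Π n) t ⟨
  (Z · listSum powerSeriesRing (partitionTerm powerSeriesRing 𝔼 H) (Π n)) t
    ≡⟨ ·-cong {Z} (λ _ → refl) (κ-setPartitions H 𝔼-isExpectation fzero (tabulate fsuc)) t ⟩
  (Z · κ powerSeriesRing 𝔼 H fzero (tabulate fsuc)) t
    ∎
  where
  open ≡-Reasoning
  t = toMonomial p
  term : ∀ α → möbius α * ⨀ h α p ≡ (Z · partitionTerm powerSeriesRing 𝔼 H α) t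
  term α@(B ∷ Bs) = begin
    möbius α * ⨀ h α p                                   ≡⟨ cong (möbius α *_) (⨀-blockProduct h≡H H-resp B Bs p) ⟩
    möbius α * (Z · W) t                                 ≡⟨ scale·F (möbius α) (Z · W) t ⟨
    (scale (möbius α) · (Z · W)) t                       ≡⟨ ·-cong (signedFactorial-scale (length Bs)) (λ _ → refl) t ⟨
    (signedFactorial powerSeriesRing (length Bs) · (Z · W)) t ≡⟨ PS.x∙yz≈y∙xz (signedFactorial powerSeriesRing (length Bs)) Z W t ⟩
    (Z · partitionTerm powerSeriesRing 𝔼 H α) t          ∎
    where W = blockProduct powerSeriesRing 𝔼 H α

connectedS-powerSum : ∀ {n} (k : Fin (suc (suc n)) → ℕ) f (f-id? : ∀ i → Dec (IsId (f i))) →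
                      connected (λ i → S (k i) (f i) (f-id? i)) ≗ powerSum (total k) (associated f)
connectedS-powerSum {n} k f f-id? p = begin
  connected (λ i → S (k i) (f i) (f-id? i)) p
    ≡⟨ connected-κ {H = λ i rs → c i + powerSumFrom 1 (k i) (f i) rs}
         (λ i p → cong (c i +_) (powerSum-toMonomial (k i) (f i) p))
         (λ i r≋s → cong (c i +_) (powerSumFrom-respects (k i) (f i) 1 r≋s)) p ⟩
  (Z · κ powerSeriesRing 𝔼 (λ i rs → c i + powerSumFrom 1 (k i) (f i) rs) fzero (tabulate fsuc)) (toMonomial p)
    ≡⟨ ·-cong {Z} (λ _ → refl) (κ-shifted-powerSum k f c) (toMonomial p) ⟩
  (Z · 𝔼 Q) (toMonomial p)
    ≡⟨ Z·𝔼 Q (toMonomial p) ⟩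
  Q (toMonomial p)
    ≡⟨ powerSum-toMonomial (total k) (associated f) p ⟨
  powerSum (total k) (associated f) p
    ∎
  where
  open ≡-Reasoning
  Q = powerSumFrom 1 (total k) (associated f)
  c : Fin (suc (suc n)) → ℚ
  c i = - (bernoulli (suc (k i)) * (1ℤ / (2 ℕ.* suc (k i)))) * δ (f-id? i)

-- The Kronecker delta and the exceptional case

S-irrelevant : ∀ k f (f-id? f-id?′ : Dec (IsId f)) → S k f f-id? ≗ S k f f-id?′
S-irrelevant k f (yes _)    (yes _)    p = refl
S-irrelevant k f (no  _)    (no  _)    p = refl
S-irrelevant k f (yes f≐id) (no  f≢id) p = contradiction f≐id f≢id
S-irrelevant k f (no  f≢id) (yes f≐id) p = contradiction f≐id f≢id

-- If `g` is the identity, a nonzero Bernoulli number would make the case exceptional. Equality of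
-- rationals is decidable, so the number is 0.
S-unexceptional : ∀ {n} k g → 2 ≤ n → ¬ Exceptional n k g → (g-id? : Dec (IsId g)) → S k g g-id? ≗ powerSum k g
S-unexceptional k g 2≤n ¬exceptional g-id? p = trans (cong (_+ powerSum k g p) (vanishing g-id?)) (ℚ.+-identityˡ _)
  where
  B c : ℚ
  B = bernoulli (suc k)
  c = 1ℤ / (2 ℕ.* suc k)
  vanishing : ∀ (g-id? : Dec (IsId g)) → - (B * c) * δ g-id? ≡ 0ℚ
  vanishing (no  _)    = ℚ.*-zeroʳ (- (B * c))
  vanishing (yes g≐id) = trans (ℚ.*-identityʳ (- (B * c))) (cong -_ (trans
    (cong (_* c) (decidable-stable (B ℚ.≟ 0ℚ) λ B≢0 → ¬exceptional (2≤n , g≐id , B≢0))) (ℚ.*-zeroˡ c)))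

theorem3p5p4 : (∀ n (k : Fin (suc n) → ℕ) → (∀ i → NonZero (k i)) →
    (f : Fin (suc n) → Arith) (f-id? : ∀ i → Dec (IsId (f i))) →
    ∃ λ (g : Arith) →
    (g ≐ associated f) ×
    (¬ Exceptional (suc n) (total k) g → (g-id? : Dec (IsId g)) →
    connected (λ i → S (k i) (f i) (f-id? i)) ≗ S (total k) g g-id?) ×
    (Exceptional (suc n) (total k) g →
    connected (λ i → S (k i) (f i) (f-id? i)) ≗ powerSum (total k) g))
    ×
    (∀ n (f : Fin (suc (suc n)) → Arith) → IsId (f fzero) →
    ∂ (associated f) ≐ λ m → f fzero m * ∂ (associated (f ∘ fsuc)) m)
theorem3p5p4 = part-i , ∂-associated
  where
  -- The form that `connected` and `associated` take for one function: one partition, one block,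
  -- weight 1.
  single : ∀ x → 1ℚ * (x * 1ℚ) + 0ℚ ≡ x
  single x = trans (ℚ.+-identityʳ _) (trans (ℚ.*-identityˡ _) (ℚ.*-identityʳ x))

  part-i : ∀ n (k : Fin (suc n) → ℕ) → (∀ i → NonZero (k i)) →
    (f : Fin (suc n) → Arith) (f-id? : ∀ i → Dec (IsId (f i))) →
    ∃ λ (g : Arith) →
    (g ≐ associated f) ×
    (¬ Exceptional (suc n) (total k) g → (g-id? : Dec (IsId g)) →
    connected (λ i → S (k i) (f i) (f-id? i)) ≗ S (total k) g g-id?) ×
    (Exceptional (suc n) (total k) g →
    connected (λ i → S (k i) (f i) (f-id? i)) ≗ powerSum (total k) g)
  -- Taking `f fzero` itself as witness makes both decisions concern the same proposition, so the
  -- constants in `S` agree. Being exceptional would require 2 ≤ 1.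
  part-i zero k _ f f-id? = f fzero , (λ m → sym (single (f fzero m))) ,
    (λ _ g-id? p → trans (single (S (k fzero) (f fzero) (f-id? fzero) p)) (trans
      (S-irrelevant (k fzero) (f fzero) (f-id? fzero) g-id? p)
      (cong (λ k₀ → S k₀ (f fzero) g-id? p) (sym (ℕ.+-identityʳ (k fzero)))))) ,
    λ { (s≤s () , _) }
  part-i (suc n) k _ f f-id? = associated f , (λ _ → refl) ,
    (λ ¬exceptional g-id? p → trans (connectedS-powerSum k f f-id? p)
      (sym (S-unexceptional (total k) (associated f) (s≤s (s≤s z≤n)) ¬exceptional g-id? p))) ,
    (λ _ → connectedS-powerSum k f f-id?)
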